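{- We have $$P(t,x,y,z)=\frac{2y}{1-yz}\left(P(t,x,z)-P\!\left(t,xyz,\frac1y\right)\right).$$
   Context: $\mathcal S_n$ is the set of permutations of $[n]=\{1,\dots,n\}$. A permutation in $\mathcal S_n$ is an odd order permutation if all its cycles (including fixed points) have odd length. For a cycle $c=(c_1c_2\cdots c_k)$, put $\mathrm{cdes}(c)=|\{i\in[k]: c_i>c_{i+1}\}|$ with $c_{k+1}=c_1$, and $\mathrm{casc}(c)=k-\mathrm{cdes}(c)$. Define $M(\pi)=\sum_c\min(\mathrm{cdes}(c),\mathrm{casc}(c))$, the sum over all cycles $c$ of $\pi$. A word $u$ is a factor of a word $w$ if $w=xuy$ for some (possibly empty) words $x,y$; $u$ is a cyclic factor of $\pi\in\mathcal S_n$ if $u$ is a factor of some word $v$ such that $(v)$ is a cycle of $\pi$ (any cyclic rotation of the cycle notation is allowed). $p_{n,d}(i,j)$ is the number of odd order permutations $\pi$ of length $n$ with $M(\pi)=d$ which have the word $i\,n\,j$ as a cyclic factor. Two formal power series, distinguished by their number of arguments, are defined: $$P(t,x,y)=\sum_{n\ge3}\sum_{d\ge0}\sum_{j=2}^{n-1}\frac{p_{n,d}(1,j)\,t^dx^ny^j}{(j-2)!\,(n-j-1)!},$$ $$P(t,x,y,z)=\sum_{n\ge3}\sum_{d\ge0}\ \sum_{1\le i<j\le n-1}\frac{2\,p_{n,d}(i,j)\,t^dx^ny^iz^j}{(j-i-1)!\,(n-j+i-2)!}.$$ Here $P(t,xyz,1/y)$ denotes the termwise substitution $x\mapsto xyz$,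 $y\mapsto 1/y$ in $P(t,x,y)$ (its terms contain only nonnegative powers of $y$), and $\frac1{1-yz}$ is expanded as a power series in $yz$. -}

module Defs where

open import Data.Bool.Base using (if_then_else_)
open import Data.Fin.Base as Fin using (Fin; toℕ)
import Data.Fin.Properties as Fin
open import Data.Fin.Permutation as Perm using (Permutation′; _⟨$⟩ʳ_)
open import Data.Integer.Base using (+_)
open import Data.List.Base
  using (List; []; _∷_; _∷ʳ_; allFin; cartesianProductWith; filter; foldr;
         iterate; length; map; takeWhile; upTo; zip)
import Data.List.Membership.Setoid as Membership
import Data.List.Membership.Setoid.Properties as Membershipₚ
import Data.List.Membership.Propositional.Properties as ∈ₚ
open import Data.List.Relation.Binary.Infix.Heterogeneous using (Infix)
open import Data.List.Relation.Binary.Infix.Heterogeneous.Properties using (infix?)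
open import Data.List.Relation.Unary.All using (All; all?; [])
open import Data.List.Relation.Unary.AllPairs using ([]; _∷_)
open import Data.List.Relation.Unary.Any using (here)
import Data.List.Relation.Unary.Unique.Propositional.Properties as Unique≡
import Data.List.Relation.Unary.Unique.Setoid as Unique
import Data.List.Relation.Unary.Unique.Setoid.Properties as Uniqueₚ
open import Data.Nat.Base
  using (ℕ; zero; suc; _+_; _*_; _∸_; _⊓_; _<_; _!)
open import Data.Nat.ListAction using (sum)
open import Data.Nat.Divisibility using (_∣_; _∣?_)
open import Data.Nat.Properties
  using (_≟_; _≤?_; _<?_; _!*_!≢0; ≤-trans; ≤⇒≯; m∸n≤m)
open import Data.Product.Base using (_×_; _,_; ∃)
import Data.Rational.Base as ℚ
open ℚ using (ℚ; 0ℚ; 1ℚ)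
open import Data.Vec.Base using (Vec; []; _∷_)
open import Data.Vec.Properties using (≡-dec)
open import Function.Base using (_∘_)
open import Level using (0ℓ)
open import Relation.Binary.Bundles using (Setoid)
open import Relation.Binary.PropositionalEquality
  using (_≡_; refl; sym; trans; cong; setoid)
open import Relation.Nullary using (Dec; does; ¬_; yes; no)
open import Relation.Nullary.Decidable using (¬?; _×-dec_; dec-false)

------------------------------------------------------------------------
-- Permutations.  Fin n stands for [n], with a : Fin n read as toℕ a + 1.

-- Each permutation of [n] occurs exactly once, up to pointwise equality:
-- see permutations-complete and permutations-unique.
permutations : ∀ n → List (Permutation′ n)
permutations zero    = Perm.id ∷ []
permutations (suc n) =
  cartesianProductWith (Perm.insert Fin.zero) (allFin (suc n)) (permutations n)

label : ∀ {n} → Fin n → ℕ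
label a = suc (toℕ a)

-- The word a, π a, π² a, … stopping just before the first return to a
-- (which happens within n steps).  As a varies this gives every way of
-- writing every cycle of π, all cyclic rotations included.
cycleWord : ∀ {n} → Permutation′ n → Fin n → List ℕ
cycleWord {n} π a =
  map label
    (a ∷ takeWhile (¬? ∘ (Fin._≟ a)) (iterate (π ⟨$⟩ʳ_) (π ⟨$⟩ʳ a) n))

-- Every cycle once, written starting from its least element.
cycles : ∀ {n} → Permutation′ n → List (List ℕ)
cycles {n} π =
  map (cycleWord π)
    (filter (λ a → all? (label a ≤?_) (cycleWord π a)) (allFin n))

OddOrder : ∀ {n} → Permutation′ n → Set
OddOrder π = All (λ c → ¬ (2 ∣ length c)) (cycles π)

oddOrder? : ∀ {n} (π : Permutation′ n) → Dec (OddOrder π)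
oddOrder? π = all? (λ c → ¬? (2 ∣? length c)) (cycles π)

cdes : List ℕ → ℕ
cdes []       = 0
cdes (x ∷ xs) =
  length (filter (λ (c , c′) → c′ <? c) (zip (x ∷ xs) (xs ∷ʳ x)))

casc : List ℕ → ℕ
casc c = length c ∸ cdes c

M : ∀ {n} → Permutation′ n → ℕ
M π = sum (map (λ c → cdes c ⊓ casc c) (cycles π))

CyclicFactor : ∀ {n} → List ℕ → Permutation′ n → Set
CyclicFactor u π = ∃ λ a → Infix _≡_ u (cycleWord π a)

cyclicFactor? : ∀ {n} u (π : Permutation′ n) → Dec (CyclicFactor u π)
cyclicFactor? u π = Fin.any? (λ a → infix? _≟_ u (cycleWord π a))

p : (n d i j : ℕ) → ℕ
p n d i j =
  length (filter (λ π → oddOrder? π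
                    ×-dec (M π ≟ d)
                    ×-dec cyclicFactor? (i ∷ n ∷ j ∷ []) π)
                 (permutations n))

------------------------------------------------------------------------
-- Formal power series in k variables over ℚ, given by their coefficients
-- at each exponent vector.

Series : ℕ → Set
Series k = Vec ℕ k → ℚ

∑≤ : ℕ → (ℕ → ℚ) → ℚ
∑≤ m f = foldr ℚ._+_ 0ℚ (map f (upTo (suc m)))

infixl 7 _⊛_
infixl 6 _⊖_

_⊖_ : ∀ {k} → Series k → Series k → Series k
(F ⊖ G) e = F e ℚ.- G e

-- Cauchy product.
_⊛_ : ∀ {k} → Series k → Series k → Series k
(F ⊛ G) []      = F [] ℚ.* G []
(F ⊛ G) (m ∷ e) = ∑≤ m λ a → ((F ∘ (a ∷_)) ⊛ (G ∘ ((m ∸ a) ∷_))) e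

infix 5 _when_

_when_ : ∀ {A : Set} → ℚ → Dec A → ℚ
q when A? = if does A? then q else 0ℚ

infix 8 _·X^_

_·X^_ : ∀ {k} → ℚ → Vec ℕ k → Series k
(q ·X^ e) e′ = q when ≡-dec _≟_ e′ e

infix 8 _/[_!*_!]

_/[_!*_!] : ℕ → ℕ → ℕ → ℚ
q /[ a !* b !] = (+ q ℚ./ (a ! * b !)) {{a !* b !≢0}}

------------------------------------------------------------------------
-- The generating functions.  In three variables the exponent vector
-- d ∷ n ∷ j ∷ [] is the monomial t^d x^n y^j; in four variables
-- d ∷ n ∷ a ∷ b ∷ [] is t^d x^n y^a z^b.

P₃ : Series 3
P₃ (d ∷ n ∷ j ∷ []) =
  p n d 1 j /[ (j ∸ 2) !* (n ∸ j ∸ 1) !]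
    when ((3 ≤? n) ×-dec (2 ≤? j) ×-dec (j ≤? n ∸ 1))

-- The second factorial is that of n - j + i - 2; the additions come first
-- so that truncated subtraction agrees with subtraction in ℤ.
P₄ : Series 4
P₄ (d ∷ n ∷ i ∷ j ∷ []) =
  (2 * p n d i j) /[ (j ∸ i ∸ 1) !* (n + i ∸ j ∸ 2) !]
    when ((3 ≤? n) ×-dec (1 ≤? i) ×-dec (i <? j) ×-dec (j ≤? n ∸ 1))

-- F(t,x,z)
_⟨t,x,z⟩ : Series 3 → Series 4
(F ⟨t,x,z⟩) (d ∷ n ∷ a ∷ b ∷ []) = F (d ∷ n ∷ b ∷ []) when (a ≟ 0)

-- F(t,xyz,1/y): the term t^d x^n y^j of F becomes t^d x^n y^(n-j) z^n, so
-- t^d x^n y^a z^b arises only when b = n and a ≤ n, from j = n - a.  This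
-- presupposes that F has no terms with j > n; for P₃ see P₃-support.
_⟨t,xyz,1/y⟩ : Series 3 → Series 4
(F ⟨t,xyz,1/y⟩) (d ∷ n ∷ a ∷ b ∷ []) =
  F (d ∷ n ∷ n ∸ a ∷ []) when ((b ≟ n) ×-dec (a ≤? n))

2y : Series 4
2y = (+ 2 ℚ./ 1) ·X^ (0 ∷ 0 ∷ 1 ∷ 0 ∷ [])

-- ∑ₖ (yz)^k
1/⟨1-yz⟩ : Series 4
1/⟨1-yz⟩ (d ∷ n ∷ a ∷ b ∷ []) = 1ℚ when ((d ≟ 0) ×-dec (n ≟ 0) ×-dec (a ≟ b))

------------------------------------------------------------------------
-- Facts showing that the encodings above are adequate.

when-no : ∀ {A : Set} q (A? : Dec A) → ¬ A → q when A? ≡ 0ℚ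
when-no q A? ¬A = cong (λ b → if b then q else 0ℚ) (dec-false A? ¬A)

P₃-support : ∀ d n j → n < j → P₃ (d ∷ n ∷ j ∷ []) ≡ 0ℚ
P₃-support d n j n<j =
  when-no _ ((3 ≤? n) ×-dec (2 ≤? j) ×-dec (j ≤? n ∸ 1))
    λ (_ , _ , j≤n-1) → ≤⇒≯ (≤-trans j≤n-1 (m∸n≤m n 1)) n<j

permutationSetoid : ℕ → Setoid 0ℓ 0ℓ
permutationSetoid n = record
  { Carrier       = Permutation′ n
  ; _≈_           = Perm._≈_
  ; isEquivalence = record
    { refl  = λ _ → refl
    ; sym   = λ π≈ρ i → sym (π≈ρ i)
    ; trans = λ π≈ρ ρ≈σ i → trans (π≈ρ i) (ρ≈σ i)
    }
  }

insert-cong : ∀ {n} i {j j′} {π ρ : Permutation′ n} → j ≡ j′ → π Perm.≈ ρ →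
              Perm.insert i j π Perm.≈ Perm.insert i j′ ρ
insert-cong i refl π≈ρ k with i Fin.≟ k
... | yes _ = refl
... | no  _ = cong (Fin.punchIn _) (π≈ρ _)

insert-injective : ∀ {n} {j j′} {π ρ : Permutation′ n} →
  Perm.insert Fin.zero j π Perm.≈ Perm.insert Fin.zero j′ ρ →
  j ≡ j′ × π Perm.≈ ρ
insert-injective {j = j} eq with refl ← eq Fin.zero =
  refl , λ k → Fin.punchIn-injective j _ _ (eq (Fin.suc k))

permutations-complete : ∀ n (π : Permutation′ n) →
  Membership._∈_ (permutationSetoid n) π (permutations n)
permutations-complete zero    π = here λ ()
permutations-complete (suc n) π =
  Membershipₚ.∈-resp-≈ S
    {x = Perm.insert Fin.zero (π ⟨$⟩ʳ Fin.zero) (Perm.remove Fin.zero π)} {y = π}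
    (Perm.insert-remove Fin.zero π)
    (Membershipₚ.∈-cartesianProductWith⁺ (setoid (Fin (suc n)))
      (permutationSetoid n) S
      (λ {j} {j′} {π} {ρ} → insert-cong Fin.zero {j} {j′} {π} {ρ})
      (∈ₚ.∈-allFin (π ⟨$⟩ʳ Fin.zero))
      (permutations-complete n (Perm.remove Fin.zero π)))
  where S = permutationSetoid (suc n)

permutations-unique : ∀ n → Unique.Unique (permutationSetoid n) (permutations n)
permutations-unique zero    = [] ∷ []
permutations-unique (suc n) =
  Uniqueₚ.cartesianProductWith⁺ (setoid (Fin (suc n))) (permutationSetoid n)
    (permutationSetoid (suc n)) (Perm.insert Fin.zero)
    (λ {j} {j′} {π} {ρ} → insert-injective {j = j} {j′} {π} {ρ})
    (Unique≡.allFin⁺ (suc n)) (permutations-unique n)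

{-# OPTIONS --safe #-}

-- Comparing coefficients of t^d x^n y^i z^j, the identity says that
-- p n d i j = p n d 1 (j - i + 1) for 1 ≤ i < j ≤ n - 1: multiplication by
-- 1 - yz shows that the right-hand side has coefficient twice that of
-- t^d x^n z^(j - i + 1) in P(t,x,z) as long as j < n, and that the two
-- series cancel beyond.
--
-- So let i, j ≥ 2 and conjugate by the cycle k ↦ k - 1 of [n - 1], which fixes
-- n and sends i n j to i - 1, n, j - 1.  Descents change only next to 1, which
-- becomes n - 1: the descent into 1 is replaced by one out of n - 1, because
-- neither neighbour of 1 is n.  Hence each cycle keeps its length and cdes.
module Submission where

open import Defs
open import Algebra.Properties.CommutativeSemigroup using (interchange)
open import Data.Bool.Base using (Bool; true; false; if_then_else_)
open import Data.Fin.Base as Fin using (Fin; toℕ; fromℕ; fromℕ<; punchIn)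
open import Data.Fin.Permutation as Perm using (Permutation′; _⟨$⟩ʳ_; _⟨$⟩ˡ_)
import Data.Fin.Properties as Fin
import Data.Integer.Base as ℤ
import Data.Integer.Properties as ℤ
open import Data.List.Base
  using (List; []; _∷_; _++_; _∷ʳ_; allFin; applyUpTo; drop; filter; foldr;
         iterate; length; map; takeWhile; zip)
open import Data.List.Extrema using (argmin; argmin-sel; f[argmin]≤f[xs])
open import Data.List.Membership.Propositional using (_∈_)
import Data.List.Membership.Propositional.Properties as ∈
import Data.List.Membership.Setoid as Membership
import Data.List.Membership.Setoid.Properties as Membershipₚ
import Data.List.Properties as List
open import Data.List.Relation.Binary.Infix.Heterogeneous as Infix using (Infix)
import Data.List.Relation.Binary.Infix.Heterogeneous.Properties as Infix
open import Data.List.Relation.Binary.Permutation.Propositional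
  using (_↭_; ↭-refl; ↭-reflexive; ↭-sym; ↭-trans; ↭ₛ⇒↭)
import Data.List.Relation.Binary.Permutation.Propositional.Properties as ↭
import Data.List.Relation.Binary.Permutation.Setoid as Permutationₛ
import Data.List.Relation.Binary.Permutation.Setoid.Properties as Permutationₛₚ
open import Data.List.Relation.Binary.Prefix.Heterogeneous using ([]; _∷_)
open import Data.List.Relation.Unary.All as All using (All; []; _∷_)
import Data.List.Relation.Unary.All.Properties as All
open import Data.List.Relation.Unary.AllPairs using ([]; _∷_)
open import Data.List.Relation.Unary.Any as Any using (here; there)
import Data.List.Relation.Unary.Unique.Propositional as Unique≡
import Data.List.Relation.Unary.Unique.Propositional.Properties as Unique≡
import Data.List.Relation.Unary.Unique.Setoid as Unique
import Data.List.Relation.Unary.Unique.Setoid.Properties as Uniqueₚ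
open import Data.Nat.Base as ℕ
  using (ℕ; zero; suc; _+_; _*_; _∸_; _⊓_; _≤_; _<_; z≤n; s≤s; z<s; _!)
open import Data.Nat.Divisibility using (_∣_)
open import Data.Nat.GeneralisedArithmetic using () renaming (iterate to power)
open import Data.Nat.ListAction using (sum)
open import Data.Nat.ListAction.Properties using (sum-↭)
import Data.Nat.Properties as ℕ
open import Data.Product.Base using (∃; _×_; _,_; proj₁; proj₂)
import Data.Rational.Base as ℚ
open ℚ using (ℚ; 0ℚ; 1ℚ)
import Data.Rational.Properties as ℚ
import Data.Rational.Unnormalised.Base as ℚᵘ
import Data.Rational.Unnormalised.Properties as ℚᵘ
open import Data.Sum.Base using (inj₁; inj₂)
open import Data.Vec.Base using (Vec; []; _∷_)
open import Data.Vec.Properties using (≡-dec)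
open import Function.Base using (_∘_)
open import Function.Definitions using (Injective)
open import Level using (0ℓ)
open import Relation.Binary.Bundles using (Setoid)
open import Relation.Binary.Definitions using (tri<; tri≈; tri>)
open import Relation.Binary.PropositionalEquality
  using (_≡_; _≢_; _≗_; refl; sym; trans; cong; cong₂; subst; subst₂; setoid;
         module ≡-Reasoning)
open import Relation.Nullary using (Dec; ¬_; does; yes; no; contradiction)
open import Relation.Nullary.Decidable using (¬?; _×-dec_; dec-true; dec-false)
open import Relation.Unary using (Pred; Decidable)

-- Orbits

-- The recurring obstacle is that `cycles` starts each cycle at its least element, and conjugation
-- does not preserve least elements. A cycle is therefore handled as a class of points, two points
-- being equivalent when their orbit lists are permutations of each other, and each statistic is
-- shown not to depend on the point chosen in the class. For `cdes` this means rewriting it as a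
-- sum, over the points a of an orbit, of the indicator of π a < a. Trading the descent into 1 for a
-- descent out of n - 1 is then a telescoping sum. The pair (i, j) on the left matches (1, j - i +
-- 1) on the right in the denominators as well: j - i - 1 = (j - i + 1) - 2 and n - j + i - 2 = n -
-- (j - i + 1) - 1. So only the counts need the bijection.

module _ {A : Set} (f : A → A) where

  power-suc : ∀ a k → power f (f a) k ≡ f (power f a k)
  power-suc a zero    = refl
  power-suc a (suc k) = power-suc (f a) k

  iterate-∷ʳ : ∀ a k → iterate f a k ∷ʳ power f a k ≡ iterate f a (suc k)
  iterate-∷ʳ a zero    = refl
  iterate-∷ʳ a (suc k) = cong (a ∷_) (iterate-∷ʳ (f a) k)

  -- Injectivity strips the common initial steps until one index is 0, so any coincidence of
  -- iterates yields a return to `a`. The bound on `k` matters because `cycleWord` inspects only `n`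
  -- iterates.
  power-return : Injective _≡_ _≡_ f → ∀ a {i j} → i < j →
                 power f a i ≡ power f a j →
                 ∃ λ k → k < j × power f (f a) k ≡ a
  power-return inj a {zero}  {suc j} _         eq = j , ℕ.≤-refl , sym eq
  power-return inj a {suc i} {suc j} (s≤s i<j) eq =
    let k , k<j , eq′ = power-return inj (f a) i<j eq
    in k , ℕ.m<n⇒m<1+n k<j , inj (trans (sym (power-suc (f a) k)) eq′)

module _ {A B : Set} {f : A → A} {g : B → B} {h : A → B}
         (h∘f≗g∘h : ∀ a → h (f a) ≡ g (h a)) where

  map-iterate : ∀ a k → map h (iterate f a k) ≡ iterate g (h a) k
  map-iterate a zero    = refl
  map-iterate a (suc k) = cong (h a ∷_)
    (trans (map-iterate (f a) k) (cong (λ b → iterate g b k) (h∘f≗g∘h a)))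

least : ∀ {P : ℕ → Set} → Decidable P → ∀ {m} → P m →
        ∃ λ k → k ≤ m × P k × (∀ l → l < k → ¬ P l)
least P? {m} Pm with P? 0
... | yes P0 = 0 , z≤n , P0 , λ _ ()
least P? {zero}  P0 | no ¬P0 = contradiction P0 ¬P0
least P? {suc m} Pm | no ¬P0 =
  let k , k≤m , Pk , below = least (P? ∘ suc) Pm
  in suc k , s≤s k≤m , Pk , λ where
    zero    _         → ¬P0
    (suc l) (s≤s l<k) → below l l<k

takeWhile-iterate : ∀ {n} (f : Fin n → Fin n) {a} y {m N} → m < N →
  power f y m ≡ a → (∀ {l} → l < m → power f y l ≢ a) →
  takeWhile (¬? ∘ (Fin._≟ a)) (iterate f y N) ≡ iterate f y m
takeWhile-iterate f {a} y {zero} {suc N} _ refl _ with y Fin.≟ y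
... | yes _   = refl
... | no  y≢y = contradiction refl y≢y
takeWhile-iterate f {a} y {suc m} {suc N} (s≤s m<N) eq below with y Fin.≟ a
... | yes y≡a = contradiction y≡a (below z<s)
... | no  _   = cong (y ∷_) (takeWhile-iterate f (f y) m<N eq (below ∘ s≤s))

-- `cycleWord π a` is `map label (orbit π a)` by definition; working with points lets permutations
-- act on the word.
orbit : ∀ {n} → Permutation′ n → Fin n → List (Fin n)
orbit {n} π a = a ∷ takeWhile (¬? ∘ (Fin._≟ a)) (iterate (π ⟨$⟩ʳ_) (π ⟨$⟩ʳ a) n)

permutation-injective : ∀ {n} (π : Permutation′ n) → Injective _≡_ _≡_ (π ⟨$⟩ʳ_)
permutation-injective π eq =
  trans (sym (Perm.inverseˡ π)) (trans (cong (π ⟨$⟩ˡ_) eq) (Perm.inverseˡ π))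

module _ {n} (π : Permutation′ n) where
  private
    f = π ⟨$⟩ʳ_

  -- The n + 1 iterates numbered 0 to n cannot all be distinct, which forces a return among the
  -- iterates that `orbit` inspects. The points `a` and `f a` share the first return time, so both
  -- words have the same length.
  orbit-iterate : ∀ a → ∃ λ k → power f (f a) k ≡ a ×
    orbit π a ≡ iterate f a (suc k) × orbit π (f a) ≡ iterate f (f a) (suc k)
  orbit-iterate a =
    let i , j , i<j , eq   = Fin.pigeonhole {m = n} (ℕ.n<1+n n) (power f a ∘ toℕ)
        m , m<j , returns  = power-return f (permutation-injective π) a i<j eq
        k , k≤m , back , below =
          least (λ l → power f (f a) l Fin.≟ a) returns
        k<n = ℕ.<-≤-trans (ℕ.≤-<-trans k≤m m<j) (ℕ.s≤s⁻¹ (Fin.toℕ<n j))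
    in k , back
     , cong (a ∷_) (takeWhile-iterate f (f a) k<n back (below _))
     , cong (f a ∷_) (takeWhile-iterate f (f (f a)) k<n
         (trans (power-suc f (f a) k) (cong f back))
         λ {l} l<k eq → below l l<k
           (permutation-injective π (trans (sym (power-suc f (f a) l)) eq)))

  orbit-next : ∀ a → orbit π (f a) ≡ map f (orbit π a)
  orbit-next a with k , _ , eq , eq′ ← orbit-iterate a = begin
    orbit π (f a)              ≡⟨ eq′ ⟩
    iterate f (f a) (suc k)    ≡⟨ map-iterate (λ _ → refl) a (suc k) ⟨
    map f (iterate f a (suc k)) ≡⟨ cong (map f) eq ⟨
    map f (orbit π a)          ∎
    where open ≡-Reasoning

  -- The orbit of `f a` is also the pointwise image of the orbit of `a`. Reading it here as a
  -- rotation shows that the cyclically adjacent pairs compared by `cdes` are exactly the pairs of a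
  -- point and its image.
  orbit-next-∷ʳ : ∀ a → orbit π (f a) ≡ drop 1 (orbit π a) ∷ʳ a
  orbit-next-∷ʳ a with k , back , eq , eq′ ← orbit-iterate a = begin
    orbit π (f a)                            ≡⟨ eq′ ⟩
    iterate f (f a) (suc k)                  ≡⟨ iterate-∷ʳ f (f a) k ⟨
    iterate f (f a) k ∷ʳ power f (f a) k     ≡⟨ cong₂ _∷ʳ_ (cong (drop 1) (sym eq)) back ⟩
    drop 1 (orbit π a) ∷ʳ a                  ∎
    where open ≡-Reasoning

  orbit-next-↭ : ∀ a → orbit π (f a) ↭ orbit π a
  orbit-next-↭ a = ↭-trans (↭-reflexive (orbit-next-∷ʳ a))
    (↭-sym (↭.∷↭∷ʳ a (drop 1 (orbit π a))))

  ∈-iterate⇒orbit-↭ : ∀ {a b} k → b ∈ iterate f a k → orbit π b ↭ orbit π a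
  ∈-iterate⇒orbit-↭ (suc k) (here refl) = ↭-refl
  ∈-iterate⇒orbit-↭ (suc k) (there b∈)  =
    ↭-trans (∈-iterate⇒orbit-↭ k b∈) (orbit-next-↭ _)

  ∈-orbit⇒orbit-↭ : ∀ {a b} → b ∈ orbit π a → orbit π b ↭ orbit π a
  ∈-orbit⇒orbit-↭ {a} {b} b∈ with k , _ , eq , _ ← orbit-iterate a =
    ∈-iterate⇒orbit-↭ (suc k) (subst (b ∈_) eq b∈)

  orbitSetoid : Setoid _ _
  orbitSetoid = record
    { Carrier       = Fin n
    ; _≈_           = λ a b → orbit π a ↭ orbit π b
    ; isEquivalence = record { refl = ↭-refl ; sym = ↭-sym ; trans = ↭-trans }
    }

map-takeWhile : ∀ {m n} {h : Fin m → Fin n} → Injective _≡_ _≡_ h → ∀ a xs →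
  map h (takeWhile (¬? ∘ (Fin._≟ a)) xs) ≡
  takeWhile (¬? ∘ (Fin._≟ h a)) (map h xs)
map-takeWhile inj a []       = refl
map-takeWhile {h = h} inj a (x ∷ xs) with x Fin.≟ a | h x Fin.≟ h a
... | yes _    | yes _     = refl
... | yes refl | no  hx≢hx = contradiction refl hx≢hx
... | no  x≢a  | yes hx≡ha = contradiction (inj hx≡ha) x≢a
... | no  _    | no  _     = cong (h x ∷_) (map-takeWhile inj a xs)

-- Lists without repetition, up to an equivalence

module _ {c ℓ} (S : Setoid c ℓ) where
  open Setoid S using (_≈_)
  open Membership S using () renaming (_∈_ to _∈ₛ_)
  open Permutationₛ S using () renaming (_↭_ to _↭ₛ_)
  private
    module P = Permutationₛ S
    module PP = Permutationₛₚ S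
    module S = Setoid S

  -- Used twice: for points up to lying on the same cycle, and for permutations up to pointwise
  -- equality. In neither case would propositional equality of the entries hold.
  unique∧⊆∧⊇⇒↭ : ∀ {xs ys} → Unique.Unique S xs → Unique.Unique S ys →
    (∀ {x} → x ∈ₛ xs → x ∈ₛ ys) → (∀ {y} → y ∈ₛ ys → y ∈ₛ xs) → xs ↭ₛ ys
  unique∧⊆∧⊇⇒↭ {[]}     {[]}     _ _ _ _ = P.↭-refl
  unique∧⊆∧⊇⇒↭ {[]}     {y ∷ ys} _ _ _ ⊇ with () ← ⊇ (here S.refl)
  unique∧⊆∧⊇⇒↭ {x ∷ xs} {ys} (x≉xs ∷ xs!) ys! ⊆ ⊇
    with us , vs , w , x≈w , ys≋ ← Membershipₚ.∈-∃++ S (⊆ (here S.refl))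
    = P.↭-trans (P.↭-prep x (unique∧⊆∧⊇⇒↭ xs! zs! xs⊆zs zs⊆xs)) (P.↭-sym ys↭)
    where
    zs = us ++ vs
    ys↭ : ys ↭ₛ x ∷ zs
    ys↭ = P.trans (P.refl ys≋) (PP.shift (S.sym x≈w) us vs)
    x∷zs! : Unique.Unique S (x ∷ zs)
    x∷zs! = PP.Unique-resp-↭ ys↭ ys!
    zs! : Unique.Unique S zs
    zs! with _ ∷ zs! ← x∷zs! = zs!
    x≉zs : All (λ z → ¬ (x ≈ z)) zs
    x≉zs with x≉ ∷ _ ← x∷zs! = x≉
    ≉⇒∉ : ∀ {z us} → All (λ u → ¬ (x ≈ u)) us → z ∈ₛ us → ¬ (x ≈ z)
    ≉⇒∉ (x≉u ∷ _)  (here z≈u) x≈z = x≉u (S.trans x≈z z≈u)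
    ≉⇒∉ (_ ∷ x≉us) (there z∈) x≈z = ≉⇒∉ x≉us z∈ x≈z
    xs⊆zs : ∀ {z} → z ∈ₛ xs → z ∈ₛ zs
    xs⊆zs z∈xs with PP.∈-resp-↭ ys↭ (⊆ (there z∈xs))
    ... | here z≈x  = contradiction (S.sym z≈x) (≉⇒∉ x≉xs z∈xs)
    ... | there z∈  = z∈
    zs⊆xs : ∀ {z} → z ∈ₛ zs → z ∈ₛ xs
    zs⊆xs z∈zs with ⊇ (PP.∈-resp-↭ (P.↭-sym ys↭) (there z∈zs))
    ... | here z≈x  = contradiction (S.sym z≈x) (≉⇒∉ x≉zs z∈zs)
    ... | there z∈  = z∈


module _ {c ℓ} (S : Setoid c ℓ) where
  open Setoid S using (_≈_)

  ≡-unique⇒unique : ∀ {P : Setoid.Carrier S → Set} →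
    (∀ {x y} → P x → P y → x ≈ y → x ≡ y) →
    ∀ {xs} → All P xs → Unique≡.Unique xs → Unique.Unique S xs
  ≡-unique⇒unique inj []         []           = []
  ≡-unique⇒unique inj (px ∷ pxs) (x≢xs ∷ xs!) =
    All.zipWith (λ (py , x≢y) x≈y → x≢y (inj px py x≈y)) (pxs , x≢xs)
    ∷ ≡-unique⇒unique inj pxs xs!

-- One representative for each cycle

module _ {n} (π : Permutation′ n) where

  IsLeast : Fin n → Set
  IsLeast a = All (label a ≤_) (cycleWord π a)

  isLeast? : Decidable IsLeast
  isLeast? a = All.all? (label a ℕ.≤?_) (cycleWord π a)

  -- By definition `cycles π` is `map (cycleWord π)` of this list.
  representatives : List (Fin n)
  representatives = filter isLeast? (allFin n)

  isLeast⇒≤ : ∀ {a b} → IsLeast a → orbit π a ↭ orbit π b → label a ≤ label b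
  isLeast⇒≤ a-least a∼b =
    All.lookup (All.map⁻ a-least) (↭.∈-resp-↭ (↭-sym a∼b) (here refl))

  representatives-unique : Unique.Unique (orbitSetoid π) representatives
  representatives-unique = ≡-unique⇒unique (orbitSetoid π)
    (λ a-least b-least a∼b → Fin.toℕ-injective (ℕ.suc-injective
      (ℕ.≤-antisym (isLeast⇒≤ a-least a∼b) (isLeast⇒≤ b-least (↭-sym a∼b)))))
    (All.all-filter isLeast? (allFin n))
    (Unique≡.filter⁺ isLeast? (Unique≡.allFin⁺ n))

  representatives-complete : ∀ a → Membership._∈_ (orbitSetoid π) a representatives
  representatives-complete a = Membershipₚ.∈-resp-≈ (orbitSetoid π) m∼a
    (Any.map (λ where refl → ↭-refl)
      (∈.∈-filter⁺ isLeast? (∈.∈-allFin m) m-least))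
    where
    m : Fin n
    -- The default `a` lies on its own orbit, so the minimiser does in either case of `argmin-sel`.
    m = argmin ℕ.≤-totalOrder label a (orbit π a)
    m∈ : m ∈ orbit π a
    m∈ with argmin-sel ℕ.≤-totalOrder label a (orbit π a)
    ... | inj₁ m≡a = here m≡a
    ... | inj₂ m∈a = m∈a
    m∼a : orbit π m ↭ orbit π a
    m∼a = ∈-orbit⇒orbit-↭ π m∈
    m-least : IsLeast m
    m-least = All.map⁺ (↭.All-resp-↭ (↭-sym m∼a)
      (f[argmin]≤f[xs] ℕ.≤-totalOrder {f = label} a (orbit π a)))

-- Stated as a relation so that it covers conjugation, its inverse (by `intertwines-flip`) and, with
-- γ the identity, pointwise equality.
Intertwines : ∀ {n} (γ π ρ : Permutation′ n) → Set
Intertwines γ π ρ = ∀ a → γ ⟨$⟩ʳ (π ⟨$⟩ʳ a) ≡ ρ ⟨$⟩ʳ (γ ⟨$⟩ʳ a)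

module _ {n} {γ π ρ : Permutation′ n} (γπ≗ργ : Intertwines γ π ρ) where
  private
    g = γ ⟨$⟩ʳ_

  orbit-map : ∀ a → orbit ρ (g a) ≡ map g (orbit π a)
  orbit-map a = cong (g a ∷_) (sym (begin
    map g (takeWhile (¬? ∘ (Fin._≟ a)) (iterate (π ⟨$⟩ʳ_) (π ⟨$⟩ʳ a) n))
      ≡⟨ map-takeWhile (permutation-injective γ) a (iterate (π ⟨$⟩ʳ_) (π ⟨$⟩ʳ a) n) ⟩
    takeWhile (¬? ∘ (Fin._≟ g a)) (map g (iterate (π ⟨$⟩ʳ_) (π ⟨$⟩ʳ a) n))
      ≡⟨ cong (takeWhile (¬? ∘ (Fin._≟ g a))) (map-iterate γπ≗ργ _ n) ⟩
    takeWhile (¬? ∘ (Fin._≟ g a)) (iterate (ρ ⟨$⟩ʳ_) (g (π ⟨$⟩ʳ a)) n)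
      ≡⟨ cong (λ b → takeWhile (¬? ∘ (Fin._≟ g a)) (iterate (ρ ⟨$⟩ʳ_) b n)) (γπ≗ργ a) ⟩
    takeWhile (¬? ∘ (Fin._≟ g a)) (iterate (ρ ⟨$⟩ʳ_) (ρ ⟨$⟩ʳ g a) n) ∎))
    where open ≡-Reasoning

  orbit-map-cong : ∀ {a b} → orbit π a ↭ orbit π b → orbit ρ (g a) ↭ orbit ρ (g b)
  orbit-map-cong {a} {b} a∼b =
    subst₂ _↭_ (sym (orbit-map a)) (sym (orbit-map b)) (↭.map⁺ g a∼b)

intertwines-flip : ∀ {n} {γ π ρ : Permutation′ n} →
  Intertwines γ π ρ → Intertwines (Perm.flip γ) ρ π
intertwines-flip {γ = γ} {π} {ρ} γπ≗ργ a = begin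
  γ ⟨$⟩ˡ (ρ ⟨$⟩ʳ a)                     ≡⟨ cong (λ b → γ ⟨$⟩ˡ (ρ ⟨$⟩ʳ b)) (Perm.inverseʳ γ) ⟨
  γ ⟨$⟩ˡ (ρ ⟨$⟩ʳ (γ ⟨$⟩ʳ (γ ⟨$⟩ˡ a)))   ≡⟨ cong (γ ⟨$⟩ˡ_) (γπ≗ργ (γ ⟨$⟩ˡ a)) ⟨
  γ ⟨$⟩ˡ (γ ⟨$⟩ʳ (π ⟨$⟩ʳ (γ ⟨$⟩ˡ a)))   ≡⟨ Perm.inverseˡ γ ⟩
  π ⟨$⟩ʳ (γ ⟨$⟩ˡ a)                     ∎
  where open ≡-Reasoning

module _ {n} {γ π ρ : Permutation′ n} (γπ≗ργ : Intertwines γ π ρ) where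
  private
    g = γ ⟨$⟩ʳ_

  orbit-map-injective : ∀ {a b} → orbit ρ (g a) ↭ orbit ρ (g b) → orbit π a ↭ orbit π b
  orbit-map-injective ga∼gb =
    subst₂ (λ a b → orbit π a ↭ orbit π b) (Perm.inverseˡ γ) (Perm.inverseˡ γ)
      (orbit-map-cong {γ = Perm.flip γ} {ρ} {π}
        (intertwines-flip {γ = γ} {π} {ρ} γπ≗ργ) ga∼gb)

  -- The image of a least element need not be least in its cycle, so the two lists agree only up to
  -- the choice of a point on each cycle.
  representatives-map-↭ :
    Permutationₛ._↭_ (orbitSetoid ρ) (map g (representatives π)) (representatives ρ)
  representatives-map-↭ = unique∧⊆∧⊇⇒↭ (orbitSetoid ρ)
    (Uniqueₚ.map⁺ (orbitSetoid π) (orbitSetoid ρ)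
      (λ {a} {b} → orbit-map-injective {a} {b}) (representatives-unique π))
    (representatives-unique ρ)
    (λ {a} _ → representatives-complete ρ a)
    λ {b} _ → subst
      (λ a → Membership._∈_ (orbitSetoid ρ) a (map g (representatives π)))
      (Perm.inverseʳ γ)
      (Membershipₚ.∈-map⁺ (orbitSetoid π) (orbitSetoid ρ)
        (λ {a} {b} → orbit-map-cong {γ = γ} {π} {ρ} γπ≗ργ {a} {b})
        (representatives-complete π (γ ⟨$⟩ˡ b)))

-- Cycle statistics

𝟙 : Bool → ℕ
𝟙 b = if b then 1 else 0

sum-map-+ : ∀ {A : Set} (g h : A → ℕ) as →
  sum (map (λ a → g a + h a) as) ≡ sum (map g as) + sum (map h as)
sum-map-+ g h []       = refl
sum-map-+ g h (a ∷ as) = trans (cong (g a + h a +_) (sum-map-+ g h as))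
  (interchange ℕ.+-commutativeSemigroup (g a) (h a) (sum (map g as)) (sum (map h as)))

descent : ∀ {n} → Permutation′ n → Fin n → ℕ
descent π a = 𝟙 (does (label (π ⟨$⟩ʳ a) ℕ.<? label a))

module _ {n} (π : Permutation′ n) where
  private
    f = π ⟨$⟩ʳ_

  length-descents : ∀ as →
    length (filter (λ (c , c′) → c′ ℕ.<? c) (zip (map label as) (map label (map f as)))) ≡
    sum (map (descent π) as)
  length-descents []       = refl
  length-descents (a ∷ as) with does (label (f a) ℕ.<? label a)
  ... | true  = cong suc (length-descents as)
  ... | false = length-descents as

  -- Moving the first letter of the word to its end gives the word at the next point, which is the
  -- letterwise image under `f`. So `cdes` counts points with a smaller image.
  cdes-cycleWord : ∀ a → cdes (cycleWord π a) ≡ sum (map (descent π) (orbit π a))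
  cdes-cycleWord a = trans
    (cong (λ cs → length (filter (λ (c , c′) → c′ ℕ.<? c) (zip (cycleWord π a) cs)))
      (begin
        map label (drop 1 (orbit π a)) ∷ʳ label a
          ≡⟨ List.map-++ label (drop 1 (orbit π a)) (a ∷ []) ⟨
        map label (drop 1 (orbit π a) ∷ʳ a)
          ≡⟨ cong (map label) (orbit-next-∷ʳ π a) ⟨
        map label (orbit π (f a))
          ≡⟨ cong (map label) (orbit-next π a) ⟩
        map label (map f (orbit π a)) ∎))
    (length-descents (orbit π a))
    where open ≡-Reasoning

  cdes-cong : ∀ {a b} → orbit π a ↭ orbit π b → cdes (cycleWord π a) ≡ cdes (cycleWord π b)
  cdes-cong {a} {b} a∼b = begin
    cdes (cycleWord π a)                ≡⟨ cdes-cycleWord a ⟩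
    sum (map (descent π) (orbit π a))   ≡⟨ sum-↭ (↭.map⁺ (descent π) a∼b) ⟩
    sum (map (descent π) (orbit π b))   ≡⟨ cdes-cycleWord b ⟨
    cdes (cycleWord π b)                ∎
    where open ≡-Reasoning

  length-cong : ∀ {a b} → orbit π a ↭ orbit π b →
                length (cycleWord π a) ≡ length (cycleWord π b)
  length-cong a∼b = ↭.↭-length (↭.map⁺ label a∼b)

  cost : Fin n → ℕ
  cost a = cdes (cycleWord π a) ⊓ casc (cycleWord π a)

  cost-cong : ∀ {a b} → orbit π a ↭ orbit π b → cost a ≡ cost b
  cost-cong a∼b rewrite cdes-cong a∼b | length-cong a∼b = refl

  M-representatives : M π ≡ sum (map cost (representatives π))
  M-representatives = cong sum (sym (List.map-∘ (representatives π)))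

  -- Since `f` permutes the orbit, `e ∘ f` and `e` have the same sum over it. The additive form of
  -- the hypothesis avoids subtraction in ℕ.
  sum-orbit-telescope : ∀ {g h e : Fin n → ℕ} → (∀ a → g a + e (f a) ≡ h a + e a) →
    ∀ a → sum (map g (orbit π a)) ≡ sum (map h (orbit π a))
  sum-orbit-telescope {g} {h} {e} eq a = ℕ.+-cancelʳ-≡ (sum (map e (orbit π a))) _ _ (begin
    sum (map g (orbit π a)) + sum (map e (orbit π a))
      ≡⟨ cong (sum (map g (orbit π a)) +_) (sum-↭ (↭.map⁺ e (orbit-next-↭ π a))) ⟨
    sum (map g (orbit π a)) + sum (map e (orbit π (f a)))
      ≡⟨ cong (λ bs → sum (map g (orbit π a)) + sum (map e bs)) (orbit-next π a) ⟩
    sum (map g (orbit π a)) + sum (map e (map f (orbit π a)))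
      ≡⟨ cong (λ bs → sum (map g (orbit π a)) + sum bs) (List.map-∘ (orbit π a)) ⟨
    sum (map g (orbit π a)) + sum (map (e ∘ f) (orbit π a))
      ≡⟨ sum-map-+ g (e ∘ f) (orbit π a) ⟨
    sum (map (λ b → g b + e (f b)) (orbit π a))
      ≡⟨ cong sum (List.map-cong eq (orbit π a)) ⟩
    sum (map (λ b → h b + e b) (orbit π a))
      ≡⟨ sum-map-+ h e (orbit π a) ⟩
    sum (map h (orbit π a)) + sum (map e (orbit π a)) ∎)
    where open ≡-Reasoning

  -- Turns a cyclic factor into equations for `π`, from which the neighbours of n on its cycle can
  -- be read off.
  infix-successors : ∀ {i j k} → CyclicFactor (i ∷ j ∷ k ∷ []) π →
    ∃ λ a → label a ≡ i × label (f a) ≡ j × label (f (f a)) ≡ k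
  infix-successors {i} {j} {k} (a , inf) =
    let l , _ , eq , _ = orbit-iterate π a
    in go a (suc l) (subst (λ as → Infix _≡_ (i ∷ j ∷ k ∷ []) (map label as)) eq inf)
    where
    go : ∀ a l → Infix _≡_ (i ∷ j ∷ k ∷ []) (map label (iterate f a l)) →
         ∃ λ a → label a ≡ i × label (f a) ≡ j × label (f (f a)) ≡ k
    go a zero                (Infix.here ())
    go a (suc zero)          (Infix.here (_ ∷ ()))
    go a (suc (suc zero))    (Infix.here (_ ∷ _ ∷ ()))
    go a (suc (suc (suc l))) (Infix.here (p ∷ q ∷ r ∷ [])) = a , sym p , sym q , sym r
    go a (suc l)             (Infix.there inf)             = go (f a) l inf

module _ {n} {γ π ρ : Permutation′ n} (γπ≗ργ : Intertwines γ π ρ) where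
  private
    g = γ ⟨$⟩ʳ_

  length-cycleWord-map : ∀ a → length (cycleWord ρ (g a)) ≡ length (cycleWord π a)
  length-cycleWord-map a = begin
    length (map label (orbit ρ (g a)))       ≡⟨ List.length-map label (orbit ρ (g a)) ⟩
    length (orbit ρ (g a))                   ≡⟨ cong length (orbit-map {γ = γ} {π} {ρ} γπ≗ργ a) ⟩
    length (map g (orbit π a))               ≡⟨ List.length-map g (orbit π a) ⟩
    length (orbit π a)                       ≡⟨ List.length-map label (orbit π a) ⟨
    length (map label (orbit π a))           ∎
    where open ≡-Reasoning

  oddOrder-map : OddOrder π → OddOrder ρ
  oddOrder-map odd = All.map⁺
    (Permutationₛₚ.All-resp-↭ (orbitSetoid ρ)
      (λ {a} {b} a∼b → subst (λ l → ¬ (2 ∣ l)) (length-cong ρ {a} {b} a∼b))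
      (representatives-map-↭ {γ = γ} {π} {ρ} γπ≗ργ)
      (All.map⁺ (All.map (λ {a} → subst (λ l → ¬ (2 ∣ l)) (sym (length-cycleWord-map a)))
        (All.map⁻ odd))))

  M-map : (∀ a → cdes (cycleWord ρ (g a)) ≡ cdes (cycleWord π a)) → M ρ ≡ M π
  M-map cdes-eq = begin
    M ρ
      ≡⟨ M-representatives ρ ⟩
    sum (map (cost ρ) (representatives ρ))
      ≡⟨ sum-↭ (↭ₛ⇒↭ (Permutationₛₚ.map⁺ (orbitSetoid ρ) (setoid ℕ)
           (λ {a} {b} → cost-cong ρ {a} {b})
           (representatives-map-↭ {γ = γ} {π} {ρ} γπ≗ργ))) ⟨
    sum (map (cost ρ) (map g (representatives π)))
      ≡⟨ cong sum (List.map-∘ (representatives π)) ⟨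
    sum (map (cost ρ ∘ g) (representatives π))
      ≡⟨ cong sum (List.map-cong cost-eq (representatives π)) ⟩
    sum (map (cost π) (representatives π))
      ≡⟨ M-representatives π ⟨
    M π ∎
    where
    open ≡-Reasoning
    cost-eq : ∀ a → cost ρ (g a) ≡ cost π a
    cost-eq a rewrite cdes-eq a | length-cycleWord-map a = refl

  -- The factor is given by points rather than labels, so that γ can act on it.
  cyclicFactor-map : ∀ {as} → CyclicFactor (map label as) π →
                     CyclicFactor (map label (map g as)) ρ
  cyclicFactor-map {as} (a , inf) = g a ,
    subst (λ bs → Infix _≡_ (map label (map g as)) (map label bs))
      (sym (orbit-map {γ = γ} {π} {ρ} γπ≗ργ a))
      (Infix.map⁺ label label (Infix.map⁺ g g
        (Infix.map (λ eq → cong (label ∘ g) (Fin.toℕ-injective (ℕ.suc-injective eq)))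
          (Infix.map⁻ label label inf))))

-- Counting under conjugation

Counted : ∀ {n} → ℕ → List ℕ → Permutation′ n → Set
Counted d u π = OddOrder π × M π ≡ d × CyclicFactor u π

counted? : ∀ {n} d u → Decidable (Counted {n} d u)
counted? d u π = oddOrder? π ×-dec (M π ℕ.≟ d) ×-dec cyclicFactor? u π

-- The list of all permutations is rearranged only up to pointwise equality, so a count over it is
-- invariant only for properties that respect this equality.
counted-resp-≈ : ∀ {n d u} {π ρ : Permutation′ n} → π Perm.≈ ρ →
                 Counted d u π → Counted d u ρ
counted-resp-≈ {u = u} {π} {ρ} π≈ρ (odd , refl , a , inf) =
  oddOrder-map {γ = Perm.id} {π} {ρ} π≈ρ odd ,
  M-map {γ = Perm.id} {π} {ρ} π≈ρ (cong cdes ∘ word-≡) ,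
  a , subst (Infix _≡_ u) (sym (word-≡ a)) inf
  where
  word-≡ : ∀ a → cycleWord ρ a ≡ cycleWord π a
  word-≡ a = cong (map label)
    (trans (orbit-map {γ = Perm.id} {π} {ρ} π≈ρ a) (List.map-id (orbit π a)))

conjugate : ∀ {n} → Permutation′ n → Permutation′ n → Permutation′ n
conjugate γ π = Perm.flip γ Perm.∘ₚ π Perm.∘ₚ γ

conjugate-intertwines : ∀ {n} (γ π : Permutation′ n) → Intertwines γ π (conjugate γ π)
conjugate-intertwines γ π a = cong (λ b → γ ⟨$⟩ʳ (π ⟨$⟩ʳ b)) (sym (Perm.inverseˡ γ))

conjugate-cong : ∀ {n} (γ : Permutation′ n) {π ρ} → π Perm.≈ ρ →
                 conjugate γ π Perm.≈ conjugate γ ρ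
conjugate-cong γ π≈ρ a = cong (γ ⟨$⟩ʳ_) (π≈ρ (γ ⟨$⟩ˡ a))

conjugate-injective : ∀ {n} (γ : Permutation′ n) {π ρ} →
  conjugate γ π Perm.≈ conjugate γ ρ → π Perm.≈ ρ
conjugate-injective γ {π} {ρ} eq a = permutation-injective γ
  (trans (conjugate-intertwines γ π a)
    (trans (eq (γ ⟨$⟩ʳ a)) (sym (conjugate-intertwines γ ρ a))))

conjugate-flip : ∀ {n} (γ π : Permutation′ n) →
  conjugate γ (conjugate (Perm.flip γ) π) Perm.≈ π
conjugate-flip γ π a = trans (Perm.inverseʳ γ) (cong (π ⟨$⟩ʳ_) (Perm.inverseʳ γ))

-- Conjugation is injective, and conjugating by the inverse supplies preimages; so the image of the
-- complete list without repetition is again such a list.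
permutations-conjugate-↭ : ∀ {n} (γ : Permutation′ n) →
  Permutationₛ._↭_ (permutationSetoid n) (permutations n) (map (conjugate γ) (permutations n))
permutations-conjugate-↭ {n} γ = unique∧⊆∧⊇⇒↭ S
  (permutations-unique n)
  (Uniqueₚ.map⁺ S S (λ {π} {ρ} → conjugate-injective γ {π} {ρ}) (permutations-unique n))
  (λ {π} _ → Membershipₚ.∈-resp-≈ S {x = conjugate γ (conjugate (Perm.flip γ) π)} {y = π}
    (conjugate-flip γ π)
    (Membershipₚ.∈-map⁺ S S {f = conjugate γ} (λ {π} {ρ} → conjugate-cong γ {π} {ρ})
      {v = conjugate (Perm.flip γ) π}
      (permutations-complete n (conjugate (Perm.flip γ) π))))
  (λ {π} _ → permutations-complete n π)
  where S = permutationSetoid n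

length-filter-map : ∀ {A B : Set} {P : Pred B 0ℓ} (P? : Decidable P) (f : A → B) xs →
                    length (filter P? (map f xs)) ≡ length (filter (P? ∘ f) xs)
length-filter-map P? f []       = refl
length-filter-map P? f (x ∷ xs) with does (P? (f x))
... | true  = cong suc (length-filter-map P? f xs)
... | false = length-filter-map P? f xs

count-conjugate : ∀ {n d u v} (γ : Permutation′ n) →
  (∀ {π} → Counted d u π → Counted d v (conjugate γ π)) →
  (∀ {π} → Counted d v (conjugate γ π) → Counted d u π) →
  length (filter (counted? d u) (permutations n)) ≡
  length (filter (counted? d v) (permutations n))
count-conjugate {n} {d} {u} {v} γ to from = sym (begin
  length (filter (counted? d v) (permutations n))
    ≡⟨ Permutationₛₚ.xs↭ys⇒|xs|≡|ys| S
         (Permutationₛₚ.filter⁺ S (counted? d v) (λ {π} {ρ} → counted-resp-≈ {π = π} {ρ})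
           (permutations-conjugate-↭ γ)) ⟩
  length (filter (counted? d v) (map (conjugate γ) (permutations n)))
    ≡⟨ length-filter-map (counted? d v) (conjugate γ) (permutations n) ⟩
  length (filter (counted? d v ∘ conjugate γ) (permutations n))
    ≡⟨ cong length (List.filter-≐ (counted? d v ∘ conjugate γ) (counted? d u)
         ((λ {π} → from {π}) , λ {π} → to {π}) (permutations n)) ⟩
  length (filter (counted? d u) (permutations n)) ∎)
  where
  open ≡-Reasoning
  S = permutationSetoid n

-- Shifting the labels below n

-- In the labels: 1 ↦ n - 1, n ↦ n and k ↦ k - 1 otherwise, where n = m + 2.
shift : ∀ m → Permutation′ (2 + m)
shift m = Perm.insert (fromℕ (suc m)) (fromℕ (suc m)) (Perm.insert Fin.zero (fromℕ m) Perm.id)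

insert-same : ∀ {m n} i j (π : Perm.Permutation m n) → Perm.insert i j π ⟨$⟩ʳ i ≡ j
insert-same i j π with i Fin.≟ i
... | yes _   = refl
... | no  i≢i = contradiction refl i≢i

toℕ-punchIn-fromℕ : ∀ {n} (i : Fin n) → toℕ (punchIn (fromℕ n) i) ≡ toℕ i
toℕ-punchIn-fromℕ Fin.zero    = refl
toℕ-punchIn-fromℕ (Fin.suc i) = cong suc (toℕ-punchIn-fromℕ i)

module _ (m : ℕ) where
  private
    top = fromℕ (suc m)

  shift-punchIn : ∀ i → toℕ (shift m ⟨$⟩ʳ punchIn top i) ≡
                  toℕ (Perm.insert Fin.zero (fromℕ m) Perm.id ⟨$⟩ʳ i)
  shift-punchIn i = trans (cong toℕ (Perm.insert-punchIn top top _ i)) (toℕ-punchIn-fromℕ _)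

  shift-zero : toℕ (shift m ⟨$⟩ʳ Fin.zero) ≡ m
  shift-zero = trans (shift-punchIn Fin.zero) (Fin.toℕ-fromℕ m)

  shift-top : shift m ⟨$⟩ʳ top ≡ top
  shift-top = insert-same top top (Perm.insert Fin.zero (fromℕ m) Perm.id)

  shift-suc : ∀ {i k} → toℕ i ≡ suc k → k < m → toℕ (shift m ⟨$⟩ʳ i) ≡ k
  shift-suc {i} {k} i≡1+k k<m = begin
    toℕ (shift m ⟨$⟩ʳ i)                           ≡⟨ cong (toℕ ∘ (shift m ⟨$⟩ʳ_)) i≡ ⟩
    toℕ (shift m ⟨$⟩ʳ punchIn top (Fin.suc j))     ≡⟨ shift-punchIn (Fin.suc j) ⟩
    toℕ (punchIn (fromℕ m) j)                      ≡⟨ toℕ-punchIn-fromℕ j ⟩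
    toℕ j                                          ≡⟨ Fin.toℕ-fromℕ< k<m ⟩
    k                                              ∎
    where
    open ≡-Reasoning
    j = fromℕ< k<m
    i≡ : i ≡ punchIn top (Fin.suc j)
    i≡ = Fin.toℕ-injective (trans i≡1+k (cong suc (sym
      (trans (toℕ-punchIn-fromℕ j) (Fin.toℕ-fromℕ< k<m)))))

  -- Each constructor records the values of both `i` and its shift, so that `shift-descent` reduces
  -- by rewriting to comparisons of numbers.
  data View (i : Fin (2 + m)) : Set where
    isZero : toℕ i ≡ 0 → toℕ (shift m ⟨$⟩ʳ i) ≡ m → View i
    isSuc  : ∀ k → k < m → toℕ i ≡ suc k → toℕ (shift m ⟨$⟩ʳ i) ≡ k → View i
    isTop  : toℕ i ≡ suc m → toℕ (shift m ⟨$⟩ʳ i) ≡ suc m → View i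

  view : ∀ i → View i
  view Fin.zero    = isZero refl shift-zero
  view (Fin.suc i) with toℕ i ℕ.<? m
  ... | yes i<m = isSuc (toℕ i) i<m refl (shift-suc {Fin.suc i} refl i<m)
  ... | no  i≮m = isTop 1+i≡1+m
    (trans (cong toℕ (trans (cong (shift m ⟨$⟩ʳ_) i≡top) shift-top)) (Fin.toℕ-fromℕ (suc m)))
    where
    1+i≡1+m : suc (toℕ i) ≡ suc m
    1+i≡1+m = cong suc (ℕ.≤-antisym (ℕ.s≤s⁻¹ (Fin.toℕ<n i)) (ℕ.≮⇒≥ i≮m))
    i≡top : Fin.suc i ≡ top
    i≡top = Fin.toℕ-injective (trans 1+i≡1+m (sym (Fin.toℕ-fromℕ (suc m))))

  isFirst : Fin (2 + m) → ℕ
  isFirst i = 𝟙 (toℕ i ℕ.≡ᵇ 0)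

  -- For i a point and j its image.  The isFirst terms cancel in the sum over
  -- an orbit, so shifting preserves the number of descents of each cycle.
  shift-descent : ∀ {i j} →
    (toℕ i ≡ suc m → toℕ j ≢ 0) → (toℕ i ≡ 0 → toℕ j ≢ suc m) →
    𝟙 (toℕ (shift m ⟨$⟩ʳ j) ℕ.<ᵇ toℕ (shift m ⟨$⟩ʳ i)) + isFirst j ≡
    𝟙 (toℕ j ℕ.<ᵇ toℕ i) + isFirst i
  shift-descent {i} {j} top↛0 0↛top with view i | view j
  ... | isZero p p′ | isZero q q′
    rewrite p | p′ | q | q′ | dec-false (m ℕ.<? m) (ℕ.n≮n m) = refl
  ... | isZero p p′ | isSuc l l<m q q′
    rewrite p | p′ | q | q′ | dec-true (l ℕ.<? m) l<m = refl
  -- The identity fails in the two excluded cases. From 1 to n there is an ascent before and after,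
  -- but `isFirst i` adds one on the right; from n to 1 there is a descent before and after, but
  -- `isFirst j` adds one on the left.
  ... | isZero p p′ | isTop q q′ = contradiction q (0↛top p)
  ... | isSuc k k<m p p′ | isZero q q′
    rewrite p | p′ | q | q′ | dec-false (m ℕ.<? k) (ℕ.<⇒≯ k<m) = refl
  ... | isSuc k k<m p p′ | isSuc l l<m q q′ rewrite p | p′ | q | q′ = refl
  ... | isSuc k k<m p p′ | isTop q q′
    rewrite p | p′ | q | q′
          | dec-false (suc m ℕ.<? k) (ℕ.<⇒≯ (ℕ.m<n⇒m<1+n k<m))
          | dec-false (m ℕ.<? k) (ℕ.<⇒≯ k<m) = refl
  ... | isTop p p′ | isZero q q′ = contradiction q (top↛0 p)
  ... | isTop p p′ | isSuc l l<m q q′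
    rewrite p | p′ | q | q′
          | dec-true (l ℕ.<? suc m) (ℕ.m<n⇒m<1+n l<m)
          | dec-true (l ℕ.<? m) l<m = refl
  ... | isTop p p′ | isTop q q′ rewrite p | p′ | q | q′ = refl

  module _ (π : Permutation′ (2 + m))
           (top↛0 : ∀ {i} → toℕ i ≡ suc m → toℕ (π ⟨$⟩ʳ i) ≢ 0)
           (0↛top : ∀ {i} → toℕ i ≡ 0 → toℕ (π ⟨$⟩ʳ i) ≢ suc m) where
    private
      γ = shift m
      ρ = conjugate γ π

    cdes-shift : ∀ a → cdes (cycleWord ρ (γ ⟨$⟩ʳ a)) ≡ cdes (cycleWord π a)
    cdes-shift a = begin
      cdes (cycleWord ρ (γ ⟨$⟩ʳ a))
        ≡⟨ cdes-cycleWord ρ (γ ⟨$⟩ʳ a) ⟩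
      sum (map (descent ρ) (orbit ρ (γ ⟨$⟩ʳ a)))
        ≡⟨ cong (sum ∘ map (descent ρ))
             (orbit-map {γ = γ} {π} {ρ} (conjugate-intertwines γ π) a) ⟩
      sum (map (descent ρ) (map (γ ⟨$⟩ʳ_) (orbit π a)))
        ≡⟨ cong sum (List.map-∘ (orbit π a)) ⟨
      sum (map (descent ρ ∘ (γ ⟨$⟩ʳ_)) (orbit π a))
        ≡⟨ sum-orbit-telescope π {e = isFirst} descents a ⟩
      sum (map (descent π) (orbit π a))
        ≡⟨ cdes-cycleWord π a ⟨
      cdes (cycleWord π a) ∎
      where
      open ≡-Reasoning
      descents : ∀ b → descent ρ (γ ⟨$⟩ʳ b) + isFirst (π ⟨$⟩ʳ b) ≡ descent π b + isFirst b
      descents b = trans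
        (cong (λ c → 𝟙 (toℕ c ℕ.<ᵇ toℕ (γ ⟨$⟩ʳ b)) + isFirst (π ⟨$⟩ʳ b))
          (sym (conjugate-intertwines γ π b)))
        (shift-descent {b} {π ⟨$⟩ʳ b} top↛0 0↛top)

map-flip : ∀ {n} (γ : Permutation′ n) as → map (γ ⟨$⟩ˡ_) (map (γ ⟨$⟩ʳ_) as) ≡ as
map-flip γ []       = refl
map-flip γ (a ∷ as) = cong₂ _∷_ (Perm.inverseˡ γ) (map-flip γ as)

-- With n = m + 2, the bounds place the labels 2 + i and 2 + j between 2 and n - 1, the range in
-- which `shift m` lowers a label by one.
p-shift : ∀ m d {i j} → i < m → j < m →
  p (2 + m) d (2 + i) (2 + j) ≡ p (2 + m) d (1 + i) (1 + j)
p-shift m d {i} {j} i<m j<m =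
  count-conjugate γ (λ {π} → to {π}) (λ {π} → from {π})
  where
  γ = shift m
  u = 2 + i ∷ 2 + m ∷ 2 + j ∷ []
  v = 1 + i ∷ 2 + m ∷ 1 + j ∷ []
  a b c : Fin (2 + m)
  a = Fin.suc (fromℕ< (ℕ.m<n⇒m<1+n i<m))
  b = fromℕ (suc m)
  c = Fin.suc (fromℕ< (ℕ.m<n⇒m<1+n j<m))
  toℕ-a : toℕ a ≡ suc i
  toℕ-a = cong suc (Fin.toℕ-fromℕ< _)
  toℕ-c : toℕ c ≡ suc j
  toℕ-c = cong suc (Fin.toℕ-fromℕ< _)
  as = a ∷ b ∷ c ∷ []
  labels-≡ : ∀ {k l m i j o} → k ≡ i → l ≡ j → m ≡ o →
             _≡_ {A = List ℕ} (suc k ∷ suc l ∷ suc m ∷ []) (suc i ∷ suc j ∷ suc o ∷ [])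
  labels-≡ refl refl refl = refl
  u≡ : map label as ≡ u
  u≡ = labels-≡ toℕ-a (Fin.toℕ-fromℕ (suc m)) toℕ-c
  v≡ : map label (map (γ ⟨$⟩ʳ_) as) ≡ v
  v≡ = labels-≡ (shift-suc m {a} toℕ-a i<m)
    (trans (cong toℕ (shift-top m)) (Fin.toℕ-fromℕ (suc m))) (shift-suc m {c} toℕ-c j<m)

  module _ {π : Permutation′ (2 + m)} where
    private
      ρ = conjugate γ π
      γπ≗ργ = conjugate-intertwines γ π
      γ⁻¹ρ≗πγ⁻¹ = intertwines-flip {γ = γ} {π} {ρ} γπ≗ργ

    M-shift : CyclicFactor u π → M ρ ≡ M π
    M-shift cf = M-map {γ = γ} {π} {ρ} γπ≗ργ (cdes-shift m π top↛0 0↛top)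
      where
      -- The neighbours of n on its cycle are 2 + i and 2 + j, and neither is the label 1.
      top↛0 : ∀ {i} → toℕ i ≡ suc m → toℕ (π ⟨$⟩ʳ i) ≢ 0
      top↛0 {t} t≡top πt≡0 with infix-successors π cf
      ... | x , _ , πx≡top , ππx≡j
        with refl ← Fin.toℕ-injective (trans t≡top (sym (ℕ.suc-injective πx≡top)))
        with () ← trans (sym πt≡0) (ℕ.suc-injective ππx≡j)
      0↛top : ∀ {i} → toℕ i ≡ 0 → toℕ (π ⟨$⟩ʳ i) ≢ suc m
      0↛top {z} z≡0 πz≡top with infix-successors π cf
      ... | x , x≡i , πx≡top , _
        with refl ← permutation-injective π {z} {x}
          (Fin.toℕ-injective (trans πz≡top (sym (ℕ.suc-injective πx≡top))))
        with () ← trans (sym z≡0) (ℕ.suc-injective x≡i)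

    to : Counted d u π → Counted d v ρ
    to (odd , M≡d , cf) =
      oddOrder-map {γ = γ} {π} {ρ} γπ≗ργ odd ,
      trans (M-shift cf) M≡d ,
      subst (λ w → CyclicFactor w ρ) v≡
        (cyclicFactor-map {γ = γ} {π} {ρ} γπ≗ργ {as}
          (subst (λ w → CyclicFactor w π) (sym u≡) cf))

    from : Counted d v ρ → Counted d u π
    from (odd , M≡d , cf) =
      oddOrder-map {γ = Perm.flip γ} {ρ} {π} γ⁻¹ρ≗πγ⁻¹ odd ,
      -- The factor is carried back to `π` first, because `M-shift` separates 1 from n by means of
      -- the factor of `π`.
      trans (sym (M-shift cf′)) M≡d , cf′
      where
      cf′ : CyclicFactor u π
      cf′ = subst (λ w → CyclicFactor w π)
        (trans (cong (map label) (map-flip γ as)) u≡)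
        (cyclicFactor-map {γ = Perm.flip γ} {ρ} {π} γ⁻¹ρ≗πγ⁻¹ {map (γ ⟨$⟩ʳ_) as}
          (subst (λ w → CyclicFactor w ρ) (sym v≡) cf))

-- Each shift lowers both neighbours of n by one, until the left one is 1. The bound says that the
-- right one starts at no more than n - 1.
p-translate : ∀ m d k j → k + j < suc m →
  p (2 + m) d (1 + k) (1 + (k + j)) ≡ p (2 + m) d 1 (1 + j)
p-translate m d zero    j _             = refl
p-translate m d (suc k) j (s≤s k+j<m) = trans
  (p-shift m d (ℕ.≤-<-trans (ℕ.m≤m+n k j) k+j<m) k+j<m)
  (p-translate m d k j (ℕ.m<n⇒m<1+n k+j<m))

-- Coefficients of the generating functions

when-yes : ∀ {A : Set} q (A? : Dec A) → A → q when A? ≡ q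
when-yes q A? a = cong (λ b → if b then q else 0ℚ) (dec-true A? a)

when-zero : ∀ {A : Set} {q} (A? : Dec A) → (A → q ≡ 0ℚ) → (q when A?) ≡ 0ℚ
when-zero (yes a) q≡0 = q≡0 a
when-zero (no  _) _   = refl

∑< : ℕ → (ℕ → ℚ) → ℚ
∑< n f = foldr ℚ._+_ 0ℚ (applyUpTo f n)

∑≤≡∑< : ∀ m f → ∑≤ m f ≡ ∑< (suc m) f
∑≤≡∑< m f = cong (foldr ℚ._+_ 0ℚ) (List.map-upTo f (suc m))

∑<-cong : ∀ n {f g : ℕ → ℚ} → (∀ k → f k ≡ g k) → ∑< n f ≡ ∑< n g
∑<-cong zero    f≗g = refl
∑<-cong (suc n) f≗g = cong₂ ℚ._+_ (f≗g 0) (∑<-cong n (f≗g ∘ suc))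

∑<-zero : ∀ n {f} → (∀ {k} → k < n → f k ≡ 0ℚ) → ∑< n f ≡ 0ℚ
∑<-zero zero    f≡0 = refl
∑<-zero (suc n) f≡0 = cong₂ ℚ._+_ (f≡0 z<s) (∑<-zero n (f≡0 ∘ s≤s))

∑<-single : ∀ {n k f} → k < n → (∀ {l} → l ≢ k → f l ≡ 0ℚ) → ∑< n f ≡ f k
∑<-single {suc n} {zero}  {f} _ f≡0 =
  trans (cong (f 0 ℚ.+_) (∑<-zero n (λ _ → f≡0 λ ()))) (ℚ.+-identityʳ (f 0))
∑<-single {suc n} {suc k} {f} (s≤s k<n) f≡0 = trans
  (cong₂ ℚ._+_ (f≡0 λ ()) (∑<-single k<n (λ l≢k → f≡0 (l≢k ∘ ℕ.suc-injective))))
  (ℚ.+-identityˡ (f (suc k)))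

module _ {k} (F G : Series (suc k)) (m : ℕ) (e : Vec ℕ k) where

  ⊛-term : ℕ → ℚ
  ⊛-term a = ((F ∘ (a ∷_)) ⊛ (G ∘ ((m ∸ a) ∷_))) e

  ⊛-∑< : (F ⊛ G) (m ∷ e) ≡ ∑< (suc m) ⊛-term
  ⊛-∑< = ∑≤≡∑< m ⊛-term

⊛-zeroˡ : ∀ {k} (F G : Series k) → (∀ e → F e ≡ 0ℚ) → ∀ e → (F ⊛ G) e ≡ 0ℚ
⊛-zeroˡ F G F≡0 []      = trans (cong (ℚ._* G []) (F≡0 [])) (ℚ.*-zeroˡ (G []))
⊛-zeroˡ F G F≡0 (m ∷ e) = trans (⊛-∑< F G m e)
  (∑<-zero (suc m) {⊛-term F G m e} λ {a} _ →
    ⊛-zeroˡ (F ∘ (a ∷_)) (G ∘ ((m ∸ a) ∷_)) (λ e → F≡0 (a ∷ e)) e)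

module _ {k} (F G : Series (suc k)) {a : ℕ}
  (F≡0 : ∀ b → b ≢ a → ∀ e → F (b ∷ e) ≡ 0ℚ) where

  -- A factor concentrated at one exponent of the first variable leaves a single term of the Cauchy
  -- sum, so variables can be stripped off in turn.
  ⊛-slice : ∀ {m} → a ≤ m → ∀ e →
    (F ⊛ G) (m ∷ e) ≡ ((F ∘ (a ∷_)) ⊛ (G ∘ ((m ∸ a) ∷_))) e
  ⊛-slice {m} a≤m e = trans (⊛-∑< F G m e)
    (∑<-single {f = ⊛-term F G m e} (s≤s a≤m) λ {b} b≢a →
      ⊛-zeroˡ (F ∘ (b ∷_)) (G ∘ ((m ∸ b) ∷_)) (F≡0 b b≢a) e)

  ⊛-slice-zero : ∀ {m} → m < a → ∀ e → (F ⊛ G) (m ∷ e) ≡ 0ℚ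
  ⊛-slice-zero {m} m<a e = trans (⊛-∑< F G m e)
    (∑<-zero (suc m) {⊛-term F G m e} λ {b} b<1+m →
      ⊛-zeroˡ (F ∘ (b ∷_)) (G ∘ ((m ∸ b) ∷_))
        (F≡0 b (ℕ.<⇒≢ (ℕ.≤-<-trans (ℕ.s≤s⁻¹ b<1+m) m<a))) e)

-- The coefficients of 2y/(1 - yz)

two : ℚ
two = ℤ.+ 2 ℚ./ 1

2y-zero : ∀ e → e ≢ 0 ∷ 0 ∷ 1 ∷ 0 ∷ [] → 2y e ≡ 0ℚ
2y-zero e = when-no two (≡-dec ℕ._≟_ e (0 ∷ 0 ∷ 1 ∷ 0 ∷ []))

module _ (G : Series 4) (d n b : ℕ) where

  private
    slices : ∀ a → (2y ⊛ G) (d ∷ n ∷ a ∷ b ∷ []) ≡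
             ((λ e → 2y (0 ∷ 0 ∷ e)) ⊛ (λ e → G (d ∷ n ∷ e))) (a ∷ b ∷ [])
    slices a = trans
      (⊛-slice 2y G {0} (λ c c≢0 e → 2y-zero (c ∷ e) λ where refl → c≢0 refl)
        z≤n (n ∷ a ∷ b ∷ []))
      (⊛-slice (2y ∘ (0 ∷_)) (G ∘ (d ∷_)) {0}
        (λ c c≢0 e → 2y-zero (0 ∷ c ∷ e) λ where refl → c≢0 refl)
        z≤n (a ∷ b ∷ []))

    slice-1 : ∀ c → c ≢ 1 → ∀ e → 2y (0 ∷ 0 ∷ c ∷ e) ≡ 0ℚ
    slice-1 c c≢1 e = 2y-zero (0 ∷ 0 ∷ c ∷ e) λ where refl → c≢1 refl

  2y⊛-zero : (2y ⊛ G) (d ∷ n ∷ 0 ∷ b ∷ []) ≡ 0ℚ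
  2y⊛-zero = trans (slices 0)
    (⊛-slice-zero (λ e → 2y (0 ∷ 0 ∷ e)) (λ e → G (d ∷ n ∷ e)) slice-1 z<s (b ∷ []))

  2y⊛-suc : ∀ a → (2y ⊛ G) (d ∷ n ∷ suc a ∷ b ∷ []) ≡ two ℚ.* G (d ∷ n ∷ a ∷ b ∷ [])
  2y⊛-suc a = trans (slices (suc a)) (trans
    (⊛-slice (λ e → 2y (0 ∷ 0 ∷ e)) (λ e → G (d ∷ n ∷ e)) slice-1 (s≤s z≤n) (b ∷ []))
    (⊛-slice (λ e → 2y (0 ∷ 0 ∷ 1 ∷ e)) (λ e → G (d ∷ n ∷ a ∷ e)) {0}
      (λ c c≢0 e → 2y-zero (0 ∷ 0 ∷ 1 ∷ c ∷ e) λ where refl → c≢0 refl) z≤n []))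

-- The sum of 2 y^(k+1) z^k over all k. As `⊛` associates to the left, it is literally the first
-- factor in the theorem.
2y/⟨1-yz⟩ : Series 4
2y/⟨1-yz⟩ = 2y ⊛ 1/⟨1-yz⟩

2y/⟨1-yz⟩-off : ∀ d n a b → ¬ (d ≡ 0 × n ≡ 0 × a ≡ suc b) →
                 2y/⟨1-yz⟩ (d ∷ n ∷ a ∷ b ∷ []) ≡ 0ℚ
2y/⟨1-yz⟩-off d n zero    b _ = 2y⊛-zero 1/⟨1-yz⟩ d n b
2y/⟨1-yz⟩-off d n (suc a) b ≢ = begin
  2y/⟨1-yz⟩ (d ∷ n ∷ suc a ∷ b ∷ [])
    ≡⟨ 2y⊛-suc 1/⟨1-yz⟩ d n b a ⟩
  two ℚ.* 1/⟨1-yz⟩ (d ∷ n ∷ a ∷ b ∷ [])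
    ≡⟨ cong (two ℚ.*_) (when-no 1ℚ ((d ℕ.≟ 0) ×-dec (n ℕ.≟ 0) ×-dec (a ℕ.≟ b))
         λ (d≡0 , n≡0 , a≡b) → ≢ (d≡0 , n≡0 , cong suc a≡b)) ⟩
  two ℚ.* 0ℚ
    ≡⟨ ℚ.*-zeroʳ two ⟩
  0ℚ ∎
  where open ≡-Reasoning

2y/⟨1-yz⟩-diagonal : ∀ b → 2y/⟨1-yz⟩ (0 ∷ 0 ∷ suc b ∷ b ∷ []) ≡ two
2y/⟨1-yz⟩-diagonal b = begin
  2y/⟨1-yz⟩ (0 ∷ 0 ∷ suc b ∷ b ∷ [])
    ≡⟨ 2y⊛-suc 1/⟨1-yz⟩ 0 0 b b ⟩
  two ℚ.* 1/⟨1-yz⟩ (0 ∷ 0 ∷ b ∷ b ∷ [])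
    ≡⟨ cong (two ℚ.*_) (when-yes 1ℚ ((0 ℕ.≟ 0) ×-dec (0 ℕ.≟ 0) ×-dec (b ℕ.≟ b))
         (refl , refl , refl)) ⟩
  two ℚ.* 1ℚ
    ≡⟨ ℚ.*-identityʳ two ⟩
  two ∎
  where open ≡-Reasoning

-- Q is 2y/(1 - yz), and the results are (1 - yz) (Q ⊛ H) = 2y H read
-- coefficientwise.
module _ (Q H : Series 4)
  (Q-off : ∀ d n a b → ¬ (d ≡ 0 × n ≡ 0 × a ≡ suc b) → Q (d ∷ n ∷ a ∷ b ∷ []) ≡ 0ℚ)
  (Q-diagonal : ∀ b → Q (0 ∷ 0 ∷ suc b ∷ b ∷ []) ≡ two)
  (d n : ℕ) where

  private
    h : ℕ → ℕ → ℚ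
    h a b = H (d ∷ n ∷ a ∷ b ∷ [])

    x : ℕ → ℕ → ℚ
    x a b = (Q ⊛ H) (d ∷ n ∷ a ∷ b ∷ [])

    s : ℕ → ℕ → ℕ → ℚ
    s c a b = ((λ e → Q (0 ∷ 0 ∷ c ∷ e)) ⊛ (λ e → H (d ∷ n ∷ a ∸ c ∷ e))) (b ∷ [])

    s-zero : ∀ a b → s 0 a b ≡ 0ℚ
    s-zero a b = ⊛-zeroˡ (λ e → Q (0 ∷ 0 ∷ 0 ∷ e)) (λ e → H (d ∷ n ∷ a ∷ e))
      (λ where (c ∷ []) → Q-off 0 0 0 c λ ()) (b ∷ [])

    s-off : ∀ c b → b ≢ c → (e : Vec ℕ 0) → Q (0 ∷ 0 ∷ suc c ∷ b ∷ e) ≡ 0ℚ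
    s-off c b b≢c [] = Q-off 0 0 (suc c) b
      λ (_ , _ , 1+c≡1+b) → b≢c (sym (ℕ.suc-injective 1+c≡1+b))

    s-suc : ∀ c a b → c ≤ b → s (suc c) (suc a) b ≡ two ℚ.* h (a ∸ c) (b ∸ c)
    s-suc c a b c≤b = trans
      (⊛-slice (λ e → Q (0 ∷ 0 ∷ suc c ∷ e)) (λ e → H (d ∷ n ∷ a ∸ c ∷ e)) (s-off c) c≤b [])
      (cong (ℚ._* h (a ∸ c) (b ∸ c)) (Q-diagonal c))

    s-suc-zero : ∀ c a b → b < c → s (suc c) (suc a) b ≡ 0ℚ
    s-suc-zero c a b b<c =
      ⊛-slice-zero (λ e → Q (0 ∷ 0 ∷ suc c ∷ e)) (λ e → H (d ∷ n ∷ a ∸ c ∷ e))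
        (s-off c) b<c []

    -- For c ≤ b both sides involve only `a ∸ c` and `b ∸ c`; beyond that both vanish. Hence the sum
    -- at (2 + a, 1 + b) is one new term plus the sum at (1 + a, b).
    s-diagonal : ∀ c a b → s (2 + c) (2 + a) (1 + b) ≡ s (1 + c) (1 + a) b
    s-diagonal c a b with c ℕ.≤? b
    ... | yes c≤b = trans (s-suc (suc c) (suc a) (suc b) (s≤s c≤b)) (sym (s-suc c a b c≤b))
    ... | no  c≰b = trans (s-suc-zero (suc c) (suc a) (suc b) (s≤s (ℕ.≰⇒> c≰b)))
                      (sym (s-suc-zero c a b (ℕ.≰⇒> c≰b)))

    x-∑ : ∀ a b → x a b ≡ ∑< a (λ c → s (suc c) a b)
    x-∑ a b = begin
      x a b
        ≡⟨ ⊛-slice Q H {0}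
             (λ where c c≢0 (n ∷ a ∷ b ∷ []) → Q-off c n a b (c≢0 ∘ proj₁))
             z≤n (n ∷ a ∷ b ∷ []) ⟩
      ((Q ∘ (0 ∷_)) ⊛ (H ∘ (d ∷_))) (n ∷ a ∷ b ∷ [])
        ≡⟨ ⊛-slice (Q ∘ (0 ∷_)) (H ∘ (d ∷_)) {0}
             (λ where c c≢0 (a ∷ b ∷ []) → Q-off 0 c a b (c≢0 ∘ proj₁ ∘ proj₂))
             z≤n (a ∷ b ∷ []) ⟩
      ∑≤ a (λ c → s c a b)
        ≡⟨ ∑≤≡∑< a (λ c → s c a b) ⟩
      s 0 a b ℚ.+ ∑< a (λ c → s (suc c) a b)
        ≡⟨ cong (ℚ._+ ∑< a (λ c → s (suc c) a b)) (s-zero a b) ⟩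
      0ℚ ℚ.+ ∑< a (λ c → s (suc c) a b)
        ≡⟨ ℚ.+-identityˡ _ ⟩
      ∑< a (λ c → s (suc c) a b) ∎
      where open ≡-Reasoning

  Q⊛-0 : ∀ b → x 0 b ≡ 0ℚ
  Q⊛-0 b = x-∑ 0 b

  Q⊛-1 : ∀ b → x 1 b ≡ two ℚ.* h 0 b
  Q⊛-1 b = trans (x-∑ 1 b) (trans (ℚ.+-identityʳ (s 1 1 b)) (s-suc 0 0 b z≤n))

  Q⊛-suc-0 : ∀ a → x (suc a) 0 ≡ two ℚ.* h a 0
  Q⊛-suc-0 a = begin
    x (suc a) 0
      ≡⟨ x-∑ (suc a) 0 ⟩
    s 1 (suc a) 0 ℚ.+ ∑< a (λ c → s (2 + c) (suc a) 0)
      ≡⟨ cong₂ ℚ._+_ (s-suc 0 a 0 z≤n) (∑<-zero a (λ {c} _ → s-suc-zero (suc c) a 0 z<s)) ⟩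
    two ℚ.* h a 0 ℚ.+ 0ℚ
      ≡⟨ ℚ.+-identityʳ _ ⟩
    two ℚ.* h a 0 ∎
    where open ≡-Reasoning

  Q⊛-suc-suc : ∀ a b → x (2 + a) (1 + b) ≡ two ℚ.* h (1 + a) (1 + b) ℚ.+ x (1 + a) b
  Q⊛-suc-suc a b = begin
    x (2 + a) (1 + b)
      ≡⟨ x-∑ (2 + a) (1 + b) ⟩
    s 1 (2 + a) (1 + b) ℚ.+ ∑< (suc a) (λ c → s (2 + c) (2 + a) (1 + b))
      ≡⟨ cong₂ ℚ._+_ (s-suc 0 (suc a) (suc b) z≤n)
           (∑<-cong (suc a) (λ c → s-diagonal c a b)) ⟩
    two ℚ.* h (1 + a) (1 + b) ℚ.+ ∑< (suc a) (λ c → s (1 + c) (1 + a) b)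
      ≡⟨ cong (two ℚ.* h (1 + a) (1 + b) ℚ.+_) (x-∑ (suc a) b) ⟨
    two ℚ.* h (1 + a) (1 + b) ℚ.+ x (1 + a) b ∎
    where open ≡-Reasoning

-- The coefficients of the right-hand side

module _ (F : Series 3)
  (F-low  : ∀ d n {j} → j < 2 → F (d ∷ n ∷ j ∷ []) ≡ 0ℚ)
  (F-high : ∀ d n j → n < j → F (d ∷ n ∷ j ∷ []) ≡ 0ℚ)
  (d n : ℕ) where
  private
    difference : Series 4
    difference = F ⟨t,x,z⟩ ⊖ F ⟨t,xyz,1/y⟩

    P : ℕ → ℚ
    P j = F (d ∷ n ∷ j ∷ [])

    h : ℕ → ℕ → ℚ
    h a b = difference (d ∷ n ∷ a ∷ b ∷ [])

    -- Half of the value claimed for the coefficient at y^(a+1) z^b: with i = a + 1 and j = b, the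
    -- exponent j - i + 1 is `b ∸ a`.
    w : ℕ → ℕ → ℚ
    w a b = P (b ∸ a) when (b ℕ.<? n)

    second : ℕ → ℕ → ℚ
    second a b = P (n ∸ a) when ((b ℕ.≟ n) ×-dec (a ℕ.≤? n))

    second-no : ∀ a b → ¬ (b ≡ n × a ≤ n) → second a b ≡ 0ℚ
    second-no a b = when-no (P (n ∸ a)) ((b ℕ.≟ n) ×-dec (a ℕ.≤? n))

    second-yes : ∀ a b → b ≡ n → a ≤ n → second a b ≡ P (n ∸ a)
    second-yes a b b≡n a≤n =
      when-yes (P (n ∸ a)) ((b ℕ.≟ n) ×-dec (a ℕ.≤? n)) (b≡n , a≤n)

    w-yes : ∀ a {b} → b < n → w a b ≡ P (b ∸ a)
    w-yes a {b} = when-yes (P (b ∸ a)) (b ℕ.<? n)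

    w-no : ∀ a {b} → n ≤ b → w a b ≡ 0ℚ
    w-no a {b} n≤b = when-no (P (b ∸ a)) (b ℕ.<? n) (ℕ.≤⇒≯ n≤b)

    h-0 : ∀ b → h 0 b ≡ w 0 b
    h-0 b with ℕ.<-cmp b n
    ... | tri< b<n b≢n _ = trans
      (cong (λ q → P b ℚ.- q) (second-no 0 b (b≢n ∘ proj₁)))
      (trans (ℚ.+-identityʳ (P b)) (sym (w-yes 0 b<n)))
    ... | tri≈ _ refl _ = trans
      (cong (λ q → P b ℚ.- q) (second-yes 0 b refl z≤n))
      (trans (ℚ.+-inverseʳ (P b)) (sym (w-no 0 (ℕ.≤-refl {b}))))
    ... | tri> _ b≢n n<b = trans
      (cong₂ ℚ._-_ (F-high d n b n<b) (second-no 0 b (b≢n ∘ proj₁)))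
      (sym (w-no 0 (ℕ.<⇒≤ n<b)))

    h-suc-0 : ∀ a → h (suc a) 0 ≡ w (suc a) 0
    h-suc-0 a = trans
      (cong (λ q → 0ℚ ℚ.- q) (second-no (suc a) 0 λ where (refl , ())))
      (sym (when-zero (0 ℕ.<? n) λ _ → F-low d n z<s))

    -- A step along a diagonal keeps `b ∸ a`, so `w` can change only where 1 + b reaches n. There
    -- the subtracted series contributes `P (n ∸ (1 + a))`, which is `P (b ∸ a)`, and cancels what
    -- has been carried along.
    h-suc-suc : ∀ a b → h (suc a) (suc b) ℚ.+ w a b ≡ w (suc a) (suc b)
    h-suc-suc a b with ℕ.<-cmp (suc b) n
    ... | tri< 1+b<n 1+b≢n _ = begin
      h (suc a) (suc b) ℚ.+ w a b
        ≡⟨ cong (λ q → (0ℚ ℚ.- q) ℚ.+ w a b) (second-no (suc a) (suc b) (1+b≢n ∘ proj₁)) ⟩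
      0ℚ ℚ.+ w a b
        ≡⟨ ℚ.+-identityˡ (w a b) ⟩
      w a b
        ≡⟨ w-yes a (ℕ.<-trans (ℕ.n<1+n b) 1+b<n) ⟩
      P (b ∸ a)
        ≡⟨ w-yes (suc a) 1+b<n ⟨
      w (suc a) (suc b) ∎
      where open ≡-Reasoning
    ... | tri> _ 1+b≢n n<1+b = begin
      h (suc a) (suc b) ℚ.+ w a b
        ≡⟨ cong₂ (λ q r → (0ℚ ℚ.- q) ℚ.+ r)
             (second-no (suc a) (suc b) (1+b≢n ∘ proj₁))
             (w-no a (ℕ.s≤s⁻¹ n<1+b)) ⟩
      0ℚ
        ≡⟨ w-no (suc a) (ℕ.<⇒≤ n<1+b) ⟨
      w (suc a) (suc b) ∎
      where open ≡-Reasoning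
    ... | tri≈ _ refl _ with a ℕ.≤? b
    ...   | yes a≤b = begin
      h (suc a) (suc b) ℚ.+ w a b
        ≡⟨ cong₂ (λ q r → (0ℚ ℚ.- q) ℚ.+ r)
             (second-yes (suc a) (suc b) refl (s≤s a≤b))
             (w-yes a (ℕ.n<1+n b)) ⟩
      (0ℚ ℚ.- P (b ∸ a)) ℚ.+ P (b ∸ a)
        ≡⟨ cong (ℚ._+ P (b ∸ a)) (ℚ.+-identityˡ (ℚ.- P (b ∸ a))) ⟩
      ℚ.- P (b ∸ a) ℚ.+ P (b ∸ a)
        ≡⟨ ℚ.+-inverseˡ (P (b ∸ a)) ⟩
      0ℚ
        ≡⟨ w-no (suc a) (ℕ.≤-refl {suc b}) ⟨
      w (suc a) (suc b) ∎
      where open ≡-Reasoning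
    -- Here 1 + a exceeds n, so the subtracted series has no term; the truncated difference is 0,
    -- and `P 0` vanishes by `F-low`.
    ...   | no  a≰b = begin
      h (suc a) (suc b) ℚ.+ w a b
        ≡⟨ cong₂ (λ q r → (0ℚ ℚ.- q) ℚ.+ r)
             (second-no (suc a) (suc b) (a≰b ∘ ℕ.s≤s⁻¹ ∘ proj₂))
             (w-yes a (ℕ.n<1+n b)) ⟩
      0ℚ ℚ.+ P (b ∸ a)
        ≡⟨ ℚ.+-identityˡ (P (b ∸ a)) ⟩
      P (b ∸ a)
        ≡⟨ cong P (ℕ.m≤n⇒m∸n≡0 (ℕ.≰⇒≥ a≰b)) ⟩
      P 0
        ≡⟨ F-low d n z<s ⟩
      0ℚ
        ≡⟨ w-no (suc a) (ℕ.≤-refl {suc b}) ⟨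
      w (suc a) (suc b) ∎
      where open ≡-Reasoning

  -- Descends the diagonal to an edge a = 0 or b = 0, collecting the increments given by
  -- `h-suc-suc`.
  product-coefficient : ∀ a b →
    (2y/⟨1-yz⟩ ⊛ (F ⟨t,x,z⟩ ⊖ F ⟨t,xyz,1/y⟩)) (d ∷ n ∷ suc a ∷ b ∷ []) ≡
    two ℚ.* (F (d ∷ n ∷ b ∸ a ∷ []) when (b ℕ.<? n))
  product-coefficient zero    b       =
    trans (Q⊛-1 2y/⟨1-yz⟩ difference 2y/⟨1-yz⟩-off 2y/⟨1-yz⟩-diagonal d n b)
      (cong (two ℚ.*_) (h-0 b))
  product-coefficient (suc a) zero    =
    trans (Q⊛-suc-0 2y/⟨1-yz⟩ difference 2y/⟨1-yz⟩-off 2y/⟨1-yz⟩-diagonal d n (suc a))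
      (cong (two ℚ.*_) (h-suc-0 a))
  product-coefficient (suc a) (suc b) = begin
    (2y/⟨1-yz⟩ ⊛ difference) (d ∷ n ∷ 2 + a ∷ 1 + b ∷ [])
      ≡⟨ Q⊛-suc-suc 2y/⟨1-yz⟩ difference 2y/⟨1-yz⟩-off 2y/⟨1-yz⟩-diagonal d n a b ⟩
    two ℚ.* h (1 + a) (1 + b) ℚ.+ (2y/⟨1-yz⟩ ⊛ difference) (d ∷ n ∷ 1 + a ∷ b ∷ [])
      ≡⟨ cong (two ℚ.* h (1 + a) (1 + b) ℚ.+_) (product-coefficient a b) ⟩
    two ℚ.* h (1 + a) (1 + b) ℚ.+ two ℚ.* w a b
      ≡⟨ ℚ.*-distribˡ-+ two (h (1 + a) (1 + b)) (w a b) ⟨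
    two ℚ.* (h (1 + a) (1 + b) ℚ.+ w a b)
      ≡⟨ cong (two ℚ.*_) (h-suc-suc a b) ⟩
    two ℚ.* w (1 + a) (1 + b) ∎
    where open ≡-Reasoning

-- Matching factorials and supports

double-/ : ∀ q n .{{_ : ℕ.NonZero n}} → ℤ.+ (2 * q) ℚ./ n ≡ two ℚ.* (ℤ.+ q ℚ./ n)
-- `ℚ./` reduces to lowest terms, so the equality is checked by cross multiplication of unreduced
-- fractions.
double-/ q (suc n) = ℚ.toℚᵘ-injective (begin
  ℚ.toℚᵘ (ℤ.+ (2 * q) ℚ./ suc n)
    ≈⟨ ℚ.toℚᵘ-fromℚᵘ (ℚᵘ.mkℚᵘ (ℤ.+ (2 * q)) n) ⟩
  ℚᵘ.mkℚᵘ (ℤ.+ (2 * q)) n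
    ≈⟨ ℚᵘ.*≡* (cong₂ ℤ._*_ (ℤ.pos-* 2 q) (cong (λ k → ℤ.+ suc k) (ℕ.+-identityʳ n))) ⟩
  ℚᵘ.mkℚᵘ (ℤ.+ 2) 0 ℚᵘ.* ℚᵘ.mkℚᵘ (ℤ.+ q) n
    ≈⟨ ℚᵘ.*-congˡ {ℚᵘ.mkℚᵘ (ℤ.+ 2) 0} (ℚ.toℚᵘ-fromℚᵘ (ℚᵘ.mkℚᵘ (ℤ.+ q) n)) ⟨
  ℚ.toℚᵘ two ℚᵘ.* ℚ.toℚᵘ (ℤ.+ q ℚ./ suc n)
    ≈⟨ ℚ.toℚᵘ-homo-* two (ℤ.+ q ℚ./ suc n) ⟨
  ℚ.toℚᵘ (two ℚ.* (ℤ.+ q ℚ./ suc n)) ∎)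
  where open ℚᵘ.≃-Reasoning

double-/[!*!] : ∀ q a b → (2 * q) /[ a !* b !] ≡ two ℚ.* (q /[ a !* b !])
double-/[!*!] q a b = double-/ q (a ! * b !) {{a ℕ.!* b !≢0}}

module _ (n a b : ℕ) where
  private
    P₃? = (3 ℕ.≤? n) ×-dec (2 ℕ.≤? b ∸ a) ×-dec (b ∸ a ℕ.≤? n ∸ 1)
    P₄? = (3 ℕ.≤? n) ×-dec (1 ℕ.≤? suc a) ×-dec (suc a ℕ.<? b) ×-dec (b ℕ.≤? n ∸ 1)

    r₃ r₄ : ℕ → ℚ
    r₃ x = x /[ (b ∸ a ∸ 2) !* (n ∸ (b ∸ a) ∸ 1) !]
    r₄ x = (2 * x) /[ (b ∸ suc a ∸ 1) !* (n + suc a ∸ b ∸ 2) !]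

    module _ (1+a<b : suc a < b) (b≤n-1 : b ≤ n ∸ 1) where

      2≤b∸a : 2 ≤ b ∸ a
      2≤b∸a = ℕ.m+n≤o⇒m≤o∸n 2 1+a<b

      b∸a≤n-1 : b ∸ a ≤ n ∸ 1
      b∸a≤n-1 = ℕ.≤-trans (ℕ.m∸n≤m b a) b≤n-1

      b∸a≤n : b ∸ a ≤ n
      b∸a≤n = ℕ.≤-trans b∸a≤n-1 (ℕ.m∸n≤m n 1)

      a≤b : a ≤ b
      a≤b = ℕ.≤-trans (ℕ.n≤1+n a) (ℕ.<⇒≤ 1+a<b)

      r₄≡2r₃ : ∀ x → r₄ x ≡ two ℚ.* r₃ x
      r₄≡2r₃ x = begin
        r₄ x
          ≡⟨ cong₂ (λ l m → (2 * x) /[ l !* m !]) l-eq m-eq ⟩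
        (2 * x) /[ (b ∸ a ∸ 2) !* (n ∸ (b ∸ a) ∸ 1) !]
          ≡⟨ double-/[!*!] x (b ∸ a ∸ 2) (n ∸ (b ∸ a) ∸ 1) ⟩
        two ℚ.* r₃ x ∎
        where
        open ≡-Reasoning
        l-eq : b ∸ suc a ∸ 1 ≡ b ∸ a ∸ 2
        l-eq = trans (ℕ.∸-+-assoc b (suc a) 1)
          (trans (cong (b ∸_) (sym (ℕ.+-suc a 1))) (sym (ℕ.∸-+-assoc b a 2)))
        m-eq : n + suc a ∸ b ∸ 2 ≡ n ∸ (b ∸ a) ∸ 1
        m-eq = begin
          n + suc a ∸ b ∸ 2
            ≡⟨ cong₂ (λ x y → x ∸ y ∸ 2) (trans (ℕ.+-suc n a) (ℕ.+-comm (suc n) a))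
                 (sym (ℕ.m+[n∸m]≡n a≤b)) ⟩
          a + suc n ∸ (a + (b ∸ a)) ∸ 2
            ≡⟨ cong (_∸ 2) (ℕ.[m+n]∸[m+o]≡n∸o a (suc n) (b ∸ a)) ⟩
          suc n ∸ (b ∸ a) ∸ 2
            ≡⟨ cong (_∸ 2) (ℕ.+-∸-assoc 1 b∸a≤n) ⟩
          n ∸ (b ∸ a) ∸ 1 ∎

  -- The supports agree: 1 + a < b means 2 ≤ b - a, and for positive n the bound b ≤ n - 1 means b <
  -- n, which also bounds b - a. The counts `x` and `y` stay abstract and are compared only on this
  -- support.
  coefficient-≡ : ∀ {x y} → (3 ≤ n → suc a < b → b ≤ n ∸ 1 → x ≡ y) →
    (r₄ x when P₄?) ≡ two ℚ.* ((r₃ y when P₃?) when (b ℕ.<? n))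
  coefficient-≡ {x} {y} x≡y = go P₄?
    where
    open ≡-Reasoning
    go : Dec (3 ≤ n × 1 ≤ suc a × suc a < b × b ≤ n ∸ 1) →
         (r₄ x when P₄?) ≡ two ℚ.* ((r₃ y when P₃?) when (b ℕ.<? n))
    go (yes c@(3≤n , _ , 1+a<b , b≤n-1)) = begin
      (r₄ x when P₄?)
        ≡⟨ when-yes (r₄ x) P₄? c ⟩
      r₄ x
        ≡⟨ cong r₄ (x≡y 3≤n 1+a<b b≤n-1) ⟩
      r₄ y
        ≡⟨ r₄≡2r₃ 1+a<b b≤n-1 y ⟩
      two ℚ.* r₃ y
        ≡⟨ cong (two ℚ.*_) (when-yes (r₃ y) P₃?
             (3≤n , 2≤b∸a 1+a<b b≤n-1 , b∸a≤n-1 1+a<b b≤n-1)) ⟨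
      two ℚ.* (r₃ y when P₃?)
        ≡⟨ cong (two ℚ.*_) (when-yes (r₃ y when P₃?) (b ℕ.<? n) b<n) ⟨
      two ℚ.* ((r₃ y when P₃?) when (b ℕ.<? n)) ∎
      where
      b<n : b < n
      b<n = ℕ.≤-<-trans b≤n-1 (ℕ.∸-monoʳ-< z<s (ℕ.≤-trans (s≤s z≤n) 3≤n))
    go (no ¬c) = begin
      (r₄ x when P₄?)
        ≡⟨ when-no (r₄ x) P₄? ¬c ⟩
      0ℚ
        ≡⟨ ℚ.*-zeroʳ two ⟨
      two ℚ.* 0ℚ
        ≡⟨ cong (two ℚ.*_) rhs≡0 ⟨
      two ℚ.* ((r₃ y when P₃?) when (b ℕ.<? n)) ∎
      where
      rhs≡0 : ((r₃ y when P₃?) when (b ℕ.<? n)) ≡ 0ℚ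
      rhs≡0 = when-zero (b ℕ.<? n) λ b<n → when-no (r₃ y) P₃? λ (3≤n , 2≤b∸a , _) → ¬c
        ( 3≤n , s≤s z≤n
        -- A nonzero truncated difference forces a < b, so it is a genuine difference here.
        , ℕ.m≤o∸n⇒m+n≤o 2 (ℕ.<⇒≤ (ℕ.m∸n≢0⇒n<m (ℕ.m<n⇒n≢0 2≤b∸a))) 2≤b∸a
        , ℕ.∸-monoˡ-≤ 1 b<n )

p-translate-∸ : ∀ {n d a b} → 3 ≤ n → suc a < b → b ≤ n ∸ 1 →
                p n d (suc a) b ≡ p n d 1 (b ∸ a)
p-translate-∸ {suc (suc m)} {d} {a} {suc b} _ (s≤s a<b) b≤1+m = begin
  p (2 + m) d (suc a) (suc b)
    ≡⟨ cong (λ c → p (2 + m) d (suc a) (suc c)) (ℕ.m+[n∸m]≡n (ℕ.<⇒≤ a<b)) ⟨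
  p (2 + m) d (suc a) (suc (a + (b ∸ a)))
    ≡⟨ p-translate m d a (b ∸ a) (subst (_< suc m) (sym (ℕ.m+[n∸m]≡n (ℕ.<⇒≤ a<b))) b≤1+m) ⟩
  p (2 + m) d 1 (suc (b ∸ a))
    ≡⟨ cong (p (2 + m) d 1) (ℕ.+-∸-assoc 1 (ℕ.<⇒≤ a<b)) ⟨
  p (2 + m) d 1 (suc b ∸ a) ∎
  where open ≡-Reasoning

P₃-zero : ∀ d n {j} → j < 2 → P₃ (d ∷ n ∷ j ∷ []) ≡ 0ℚ
P₃-zero d n {j} j<2 = when-no (p n d 1 j /[ (j ∸ 2) !* (n ∸ j ∸ 1) !])
  ((3 ℕ.≤? n) ×-dec (2 ℕ.≤? j) ×-dec (j ℕ.≤? n ∸ 1))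
  λ (_ , 2≤j , _) → ℕ.<⇒≱ j<2 2≤j

theorem4p1 : P₄ ≗ 2y ⊛ 1/⟨1-yz⟩ ⊛ (P₃ ⟨t,x,z⟩ ⊖ P₃ ⟨t,xyz,1/y⟩)
-- No term is free of y: `P₄` requires i ≥ 1, and the right-hand side has the factor 2y.
theorem4p1 (d ∷ n ∷ zero ∷ b ∷ []) = trans
  (when-no ((2 * p n d 0 b) /[ (b ∸ 0 ∸ 1) !* (n + 0 ∸ b ∸ 2) !])
    ((3 ℕ.≤? n) ×-dec (1 ℕ.≤? 0) ×-dec (0 ℕ.<? b) ×-dec (b ℕ.≤? n ∸ 1)) λ where (_ , () , _))
  (sym (Q⊛-0 2y/⟨1-yz⟩ (P₃ ⟨t,x,z⟩ ⊖ P₃ ⟨t,xyz,1/y⟩) 2y/⟨1-yz⟩-off 2y/⟨1-yz⟩-diagonal d n b))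
theorem4p1 (d ∷ n ∷ suc a ∷ b ∷ []) = trans
  (coefficient-≡ n a b (p-translate-∸ {n} {d} {a} {b}))
  (sym (product-coefficient P₃ P₃-zero P₃-support d n a b))
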